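{- Let $n\geqslant 3$ be an integer. If $P$ is a generic convex $n$-gon in $\mathbb{R}^2$, then $\mathrm{xc}(P)\geqslant\sqrt{2n}$.
   Context: A polytope is the convex hull of finitely many points in some $\mathbb{R}^d$. An extension of a polytope $P\subseteq\mathbb{R}^d$ is a polytope $Q\subseteq\mathbb{R}^e$ (for some $e$) such that $P$ is the image of $Q$ under a linear projection $\mathbb{R}^e\to\mathbb{R}^d$. The size of an extension $Q$ is its number of facets. The extension complexity $\mathrm{xc}(P)$ is the minimum size of an extension of $P$. A convex $n$-gon is a convex polygon with exactly $n$ vertices. A polygon in $\mathbb{R}^2$ is called generic if the coordinates of its vertices are distinct (so that an $n$-gon has $2n$ pairwise distinct vertex coordinates) and form a set that is algebraically independent over $\mathbb{Q}$. -}

module Defs where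

open import Algebra.Apartness.Bundles using (HeytingCommutativeRing; HeytingField)
open import Algebra.Bundles using (CommutativeRing; Semiring)
open import Algebra.Module.Bundles.Raw using (RawLeftModule)
import Algebra.Definitions.RawSemiring as RawSemiringDefinitions
import Algebra.Module.Morphism.Structures as ModuleMorphisms
open import Data.Fin.Base using (Fin)
open import Data.Integer.Base as ℤ using (ℤ; +_; -[1+_])
open import Data.Nat.Base as ℕ using (ℕ; zero; suc)
open import Data.Product.Base using (Σ; ∃; ∃-syntax; _×_; _,_; proj₁)
open import Data.Rational.Base using (ℚ; 0ℚ)
open import Data.Sum.Base using (_⊎_; inj₂)
open import Data.Vec.Functional using (Vector; concat; map; zipWith; replicate)
import Data.Vec.Functional.Relation.Binary.Equality.Setoid as VectorEquality
open import Function.Bundles using (Bijection)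
open import Function.Definitions using (Injective)
open import Level using (_⊔_) renaming (suc to lsuc)
open import Relation.Binary.Bundles using (Setoid)
open import Relation.Binary.Core using (Rel)
import Relation.Binary.Construct.On as On
open import Relation.Binary.PropositionalEquality as ≡ using (_≡_; _≗_)
open import Relation.Binary.Structures using (IsStrictPartialOrder)
open import Relation.Nullary.Negation using (¬_)
open import Relation.Unary using (Pred; _∈_; _≐_)
open import Relation.Unary.Relation.Binary.Equality using (≐-setoid)

-- The real numbers, given by their defining property: a Cauchy complete
-- Archimedean ordered field.  Classically this determines ℝ up to unique
-- isomorphism; the axioms are phrased so that the constructive Cauchy reals
-- satisfy them too (no decidability of _<_ or _≈_ is assumed).
record Reals c ℓ₁ ℓ₂ : Set (lsuc (c ⊔ ℓ₁ ⊔ ℓ₂)) where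
  field
    heytingField : HeytingField c ℓ₁ ℓ₂

  open HeytingField heytingField public

  infix 4 _<_ _≤_

  field
    _<_                  : Rel Carrier ℓ₂
    isStrictPartialOrder : IsStrictPartialOrder _≈_ _<_
    <⇒#                  : ∀ {x y} → x < y → x # y
    #⇒<⊎>                : ∀ {x y} → x # y → x < y ⊎ y < x
    +-monoˡ-<            : ∀ {x y} z → x < y → x + z < y + z
    *-positive           : ∀ {x y} → 0# < x → 0# < y → 0# < x * y
    0<1                  : 0# < 1#

  commutativeRing : CommutativeRing c ℓ₁
  commutativeRing = HeytingCommutativeRing.commutativeRing heytingCommutativeRing

  open RawSemiringDefinitions (Semiring.rawSemiring (CommutativeRing.semiring commutativeRing)) public
    using (sum; product; _^_)
    renaming (_×_ to _·_)

  fromℕ : ℕ → Carrier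
  fromℕ n = n · 1#

  _≤_ : Rel Carrier ℓ₂
  x ≤ y = ¬ (y < x)

  -- The bound holds for all pairs m, n ≥ N, hence also for |s m - s n|.
  IsCauchy : (ℕ → Carrier) → Set _
  IsCauchy s = ∀ ε → 0# < ε → ∃[ N ] ∀ m n → N ℕ.≤ m → N ℕ.≤ n → s m - s n < ε

  _ConvergesTo_ : (ℕ → Carrier) → Carrier → Set _
  s ConvergesTo x = ∀ ε → 0# < ε → ∃[ N ] ∀ n → N ℕ.≤ n → (s n - x < ε) × (x - s n < ε)

  field
    archimedean : ∀ x → ∃[ n ] x < fromℕ n
    complete    : ∀ s → IsCauchy s → ∃[ x ] s ConvergesTo x

module Polytopes {c ℓ₁ ℓ₂} (ℝ : Reals c ℓ₁ ℓ₂) where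

  open Reals ℝ public

  private
    module < = IsStrictPartialOrder isStrictPartialOrder

  open VectorEquality setoid public using (_≋_; ≋-setoid)

  record IsSquareRoot (s x : Carrier) : Set (ℓ₁ ⊔ ℓ₂) where
    field
      nonNegative : 0# ≤ s
      squares     : s * s ≈ x

  0<fromℕ[1+n] : ∀ n → 0# < fromℕ (suc n)
  0<fromℕ[1+n] zero    = <.<-respʳ-≈ (sym (+-identityʳ 1#)) 0<1
  0<fromℕ[1+n] (suc n) = <.trans (0<fromℕ[1+n] n)
    (<.<-respˡ-≈ (+-identityˡ (fromℕ (suc n))) (+-monoˡ-< (fromℕ (suc n)) 0<1))

  fromℤ : ℤ → Carrier
  fromℤ (+ n)    = fromℕ n
  fromℤ -[1+ n ] = - fromℕ (suc n)

  -- In a Heyting field, x # 0# yields an inverse of x - 0#.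
  1/fromℕ[1+_] : ℕ → Carrier
  1/fromℕ[1+ n ] = proj₁ (#⇒invertible {fromℕ (suc n)} {0#} (#-sym (<⇒# (0<fromℕ[1+n] n))))

  fromℚ : ℚ → Carrier
  fromℚ q = fromℤ (ℚ.numerator q) * 1/fromℕ[1+ ℚ.denominator-1 q ]

  -- ℚ[X₁,…,X_N]: finite ℚ-linear combinations of distinct monomials.
  record Polynomial (N : ℕ) : Set where
    field
      {terms}  : ℕ
      exponent : Fin terms → Vector ℕ N
      distinct : Injective _≡_ _≗_ exponent
      coeff    : Fin terms → ℚ

  IsZero : ∀ {N} → Polynomial N → Set
  IsZero p = ∀ t → coeff t ≡ 0ℚ
    where open Polynomial p

  eval : ∀ {N} → Polynomial N → Vector Carrier N → Carrier
  eval p x = sum λ t → fromℚ (coeff t) * product λ j → x j ^ exponent t j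
    where open Polynomial p

  AlgebraicallyIndependent : ∀ {N} → Vector Carrier N → Set ℓ₁
  AlgebraicallyIndependent x = ∀ p → eval p x ≈ 0# → IsZero p

  Point : ℕ → Set c
  Point d = Vector Carrier d

  space : ℕ → RawLeftModule Carrier c ℓ₁
  space d = record
    { Carrierᴹ = Point d
    ; _≈ᴹ_     = _≋_
    ; _+ᴹ_     = zipWith _+_
    ; _*ₗ_     = λ a → map (a *_)
    ; 0ᴹ       = replicate d 0#
    ; -ᴹ_      = map (λ a → - a)
    }

  IsLinear : ∀ {e d} → (Point e → Point d) → Set (c ⊔ ℓ₁)
  IsLinear {e} {d} = ModuleMorphisms.LeftModuleMorphisms.IsLeftModuleHomomorphism (space e) (space d)

  _∙_ : ∀ {d} → Point d → Point d → Carrier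
  x ∙ y = sum (zipWith _*_ x y)

  combination : ∀ {d m} → Vector Carrier m → Vector (Point d) m → Point d
  combination μ p j = sum λ i → μ i * p i j

  record ConvexHull {d m} (p : Vector (Point d) m) (x : Point d) : Set (c ⊔ ℓ₁ ⊔ ℓ₂) where
    field
      weight      : Vector Carrier m
      nonNegative : ∀ i → 0# ≤ weight i
      sum≈1       : sum weight ≈ 1#
      isCombo     : x ≋ combination weight p

  AffinelyIndependent : ∀ {d m} → Vector (Point d) m → Set (c ⊔ ℓ₁)
  AffinelyIndependent {d} p =
    ∀ μ → sum μ ≈ 0# → combination μ p ≋ replicate d 0# → ∀ i → μ i ≈ 0#

  -- The maximal size of an affinely independent family in S is r, that is,
  -- dim S = r - 1 (with dim ∅ = -1; so the
  -- empty face counts as the facet of a single point).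
  record HasAffineRank {d ℓ} (S : Pred (Point d) ℓ) (r : ℕ) : Set (c ⊔ ℓ₁ ⊔ ℓ) where
    field
      basis       : Vector (Point d) r
      basis∈S     : ∀ i → basis i ∈ S
      independent : AffinelyIndependent basis
      maximal     : ∀ {m} (p : Vector (Point d) m) → (∀ i → p i ∈ S) →
                    AffinelyIndependent p → m ℕ.≤ r

  -- The generators may include points that are not vertices.
  record Polytope (d : ℕ) : Set c where
    field
      {size}     : ℕ
      generators : Vector (Point d) size

  ⟦_⟧ : ∀ {d} → Polytope d → Pred (Point d) (c ⊔ ℓ₁ ⊔ ℓ₂)
  ⟦ Q ⟧ = ConvexHull (Polytope.generators Q)

  record ValidInequality {d} (Q : Polytope d) : Set (c ⊔ ℓ₁ ⊔ ℓ₂) where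
    field
      normal : Point d
      bound  : Carrier
      valid  : ∀ {x} → x ∈ ⟦ Q ⟧ → normal ∙ x ≤ bound

  face : ∀ {d} {Q : Polytope d} → ValidInequality Q → Pred (Point d) (c ⊔ ℓ₁ ⊔ ℓ₂)
  face {Q = Q} h x = x ∈ ⟦ Q ⟧ × normal ∙ x ≈ bound
    where open ValidInequality h

  IsVertex : ∀ {d} → Polytope d → Pred (Point d) _
  IsVertex Q x = Σ (ValidInequality Q) λ h → face h ≐ (x ≋_)

  vertexSetoid : ∀ {d} → Polytope d → Setoid _ _
  vertexSetoid {d} Q = On.setoid {B = ∃ (IsVertex Q)} (≋-setoid d) proj₁

  IsFacet : ∀ {d} {Q : Polytope d} → Pred (ValidInequality Q) _
  IsFacet {Q = Q} h = ∃[ r ] HasAffineRank ⟦ Q ⟧ (suc r) × HasAffineRank (face h) r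

  -- Different inequalities may define the same facet, so facets are compared
  -- as sets of points.
  facetSetoid : ∀ {d} → Polytope d → Setoid _ _
  facetSetoid {d} Q =
    On.setoid {B = ∃ (IsFacet {Q = Q})} (≐-setoid (Point d) _) λ (h , _) → face h

  HasFacetCount : ∀ {d} → Polytope d → ℕ → Set _
  HasFacetCount Q k = Bijection (≡.setoid (Fin k)) (facetSetoid Q)

  image : ∀ {e d ℓ} → (Point e → Point d) → Pred (Point e) ℓ → Pred (Point d) _
  image π S y = ∃[ x ] x ∈ S × π x ≋ y

  IsExtensionOf : ∀ {e d} → Polytope e → Polytope d → Set _
  IsExtensionOf {e} {d} Q P =
    Σ (Point e → Point d) λ π → IsLinear π × image π ⟦ Q ⟧ ≐ ⟦ P ⟧

  HasExtensionOfSize : ∀ {d} → Polytope d → ℕ → Set _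
  HasExtensionOfSize P k =
    ∃[ e ] Σ (Polytope e) λ Q → IsExtensionOf Q P × HasFacetCount Q k

  record HasExtensionComplexity {d} (P : Polytope d) (k : ℕ) : Set (c ⊔ ℓ₁ ⊔ ℓ₂) where
    field
      attained : HasExtensionOfSize P k
      minimal  : ∀ {m} → HasExtensionOfSize P m → k ℕ.≤ m

  record ConvexPolygon (n : ℕ) : Set (c ⊔ ℓ₁ ⊔ ℓ₂) where
    field
      polytope : Polytope 2
      vertices : Bijection (≡.setoid (Fin n)) (vertexSetoid polytope)

    vertex : Vector (Point 2) n
    vertex i = proj₁ (Bijection.to vertices i)

    coordinates : Vector Carrier (n ℕ.* 2)
    coordinates = concat vertex

  record IsGeneric {n} (P : ConvexPolygon n) : Set (c ⊔ ℓ₁) where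
    open ConvexPolygon P
    field
      distinct    : Injective _≡_ _≈_ coordinates
      independent : AlgebraicallyIndependent coordinates

{-# OPTIONS --safe #-}

-- The conclusion is a negation, so classical reasoning is available throughout, inside ¬ ¬.
--
-- Let Q be an extension of the n-gon P with k facets. Every affine function that is
-- nonnegative on Q is on Q a nonnegative combination of the facet slacks s₁, …, sₖ. Apply
-- this to the pullback f of an inequality supporting P at a vertex v only and to
-- L f + (πᵣ - vᵣ) with L large: over any preimage w of v, πᵣ - vᵣ is a combination of
-- those slacks that vanish at w. Hence the sets of slacks vanishing over the vertices form
-- an antichain in the subsets of {1, …, k}, so that n ≥ 3 gives k ≥ 3; and vᵣ is
-- determined by the linear relations among the k + 3 functions 1, π₁, π₂, s₁, …, sₖ on Q.
-- With a basis of size ρ and σ = k + 3 - ρ remaining functions these relations have σ ρ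
-- coefficients, and the 2n coordinates of the vertices lie in the field generated by them.
-- Comparing numbers of monomials shows that 2n > σ ρ elements of such a field are
-- algebraically dependent, so 2n ≤ σ ρ ≤ ((k + 3) / 2)² ≤ k².

module Submission where

open import Defs
open import Algebra.Bundles using (CommutativeRing; RawRing)
import Algebra.Module.Morphism.Structures as ModuleMorphisms
import Algebra.Properties.CommutativeMonoid.Sum as CommutativeMonoidSum
import Algebra.Properties.Monoid.Mult.TCOptimised as MonoidMult′
import Algebra.Properties.Ring as RingProperties
import Algebra.Properties.Semiring.Exp as Exp
import Algebra.Properties.Semiring.Mult as Mult
import Algebra.Properties.Semiring.Mult.TCOptimised as Mult′
import Algebra.Properties.Semiring.Sum as Sum
import Algebra.Solver.Ring as RingSolver
open import Algebra.Solver.Ring.AlmostCommutativeRing using (fromCommutativeRing; _-Raw-AlmostCommutative⟶_)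
open import Data.Fin.Base as Fin using (Fin; zero; suc; punchIn; toℕ; fromℕ<; finToFun; funToFin; inject≤; quotRem; combine; _↑ˡ_; _↑ʳ_)
open import Data.Fin.Properties as Fin using (∀-cons; toℕ<n; toℕ-fromℕ<; toℕ-injective; finToFun-funToFin; funToFin-finToFin; remQuot-combine; inject≤-injective)
open import Data.Fin.Subset as Subset using (Subset; ∣_∣)
import Data.Fin.Subset.Properties as Subset
open import Data.Integer.Base as ℤ using (ℤ; +_; -[1+_])
import Data.Integer.Properties as ℤ
open import Data.Maybe.Base using (Maybe; just; nothing)
open import Data.Nat.Base as ℕ using (ℕ; zero; suc; z≤n; s≤s)
import Data.Nat.Coprimality as ℕ
import Data.Nat.Properties as ℕ
open import Data.Nat.Solver using (module +-*-Solver)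
open import Data.Product.Base using (∃-syntax; _×_; _,_; proj₁; proj₂; uncurry)
open import Data.Rational.Base using (ℚ; mkℚ)
open import Data.Sum.Base using (_⊎_; inj₁; inj₂; [_,_]′)
open import Data.Unit.Base using (⊤; tt)
import Data.Vec.Base as Vec
open import Data.Vec.Functional using (Vector; _∷_; _++_; concat; insertAt)
open import Data.Vec.Functional.Properties using (insertAt-lookup; insertAt-punchIn; lookup-++ˡ; lookup-++ʳ)
import Data.Vec.Properties as Vec
open import Function.Base using (_∘_)
open import Function.Bundles using (Bijection)
open import Level using (Level; _⊔_)
open import Relation.Binary.PropositionalEquality as ≡ using (_≡_; _≗_; _≢_)
import Relation.Binary.Reasoning.Setoid as SetoidReasoning
open import Relation.Binary.Structures using (IsStrictPartialOrder)
open import Relation.Nullary.Decidable using (Dec; yes; no; does; decidable-stable; dec-true; from-no; ¬?; _×-dec_; ¬¬-excluded-middle)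
open import Relation.Nullary.Negation using (¬_; contradiction)
open import Relation.Unary using (_∈_; _≐_)

-- The fibre of Q over a vertex v is a face that may have positive dimension, and Q need not be
-- full-dimensional, so v is not found by solving for a point of Q. Relations are taken instead
-- between functions on Q, represented by their values at the generators. They do not depend on the
-- coordinates chosen for Q: all that matters is a subspace of dimension ρ in a space of dimension k
-- + 3 = ρ + σ, and σ ρ is the dimension of the Grassmannian of such subspaces. πᵣ - vᵣ may take
-- both signs on Q. It is therefore written as a difference of two nonnegative functions that vanish
-- at w; at w every term of a nonnegative combination of slacks must then vanish separately. The
-- coefficients of the slacks in πᵣ - vᵣ need not be unique, but vᵣ is: at w the slacks that occur
-- are 0 and the constant function is 1. A linear system with coefficients in a field that has a
-- real solution has one in that field, and so vᵣ lies there.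

infixl 1 _>>=_

_>>=_ : ∀ {a b} {A : Set a} {B : Set b} → ¬ ¬ A → (A → ¬ ¬ B) → ¬ ¬ B
(m >>= f) k = m λ x → f x k

pure : ∀ {a} {A : Set a} → A → ¬ ¬ A
pure x k = k x

em : ∀ {a} {A : Set a} → ¬ ¬ (Dec A)
em = ¬¬-excluded-middle

-- Double negation passes through ∀ because the index set is finite; over ℕ this would be an
-- additional principle.
¬¬-∀ : ∀ {a n} {P : Fin n → Set a} → (∀ i → ¬ ¬ P i) → ¬ ¬ (∀ i → P i)
¬¬-∀ {n = zero}  ps = pure λ ()
¬¬-∀ {n = suc n} ps = do
  p  ← ps zero
  qs ← ¬¬-∀ (λ i → ps (suc i))
  pure (∀-cons p qs)

-- Integers in a commutative ring, and a ring solver with integer coefficients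

module IntegerMultiples {c ℓ} (R : CommutativeRing c ℓ) where

  open CommutativeRing R hiding (zero)
  open RingProperties ring using (-0#≈0#; -‿involutive; -‿+-comm; -‿distribˡ-*; -‿distribʳ-*)
  open Mult′ semiring using (×1-homo-*; ×-homo-+; 1+×) renaming (_×_ to _×′_)
  open SetoidReasoning setoid

  -- With the optimised multiple `fromℤ′ (+ 1)` computes to `1#`, so that `con (+ 1)` in the solver
  -- is literally `1#`; the plain multiple would give `1# + 0#`.
  fromℕ′ : ℕ → Carrier
  fromℕ′ n = n ×′ 1#

  fromℤ′ : ℤ → Carrier
  fromℤ′ (+ n)    = fromℕ′ n
  fromℤ′ -[1+ n ] = - fromℕ′ (suc n)

  private
    cancel : ∀ x y → (1# + x) - (1# + y) ≈ x - y
    cancel x y = begin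
      (1# + x) - (1# + y)     ≈⟨ +-congˡ (-‿+-comm 1# y) ⟨
      (1# + x) + (- 1# - y)   ≈⟨ +-congʳ (+-comm 1# x) ⟩
      (x + 1#) + (- 1# - y)   ≈⟨ +-assoc x 1# _ ⟩
      x + (1# + (- 1# - y))   ≈⟨ +-congˡ (+-assoc 1# _ _) ⟨
      x + ((1# - 1#) - y)     ≈⟨ +-congˡ (+-congʳ (-‿inverseʳ 1#)) ⟩
      x + (0# - y)            ≈⟨ +-congˡ (+-identityˡ _) ⟩
      x - y                   ∎

  ⊖-homo : ∀ m n → fromℤ′ (m ℤ.⊖ n) ≈ fromℕ′ m - fromℕ′ n
  ⊖-homo zero    zero    = sym (-‿inverseʳ 0#)
  ⊖-homo zero    (suc n) = sym (+-identityˡ _)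
  ⊖-homo (suc m) zero    = sym (trans (+-congˡ -0#≈0#) (+-identityʳ _))
  ⊖-homo (suc m) (suc n) = begin
    fromℤ′ (suc m ℤ.⊖ suc n)              ≡⟨ ≡.cong fromℤ′ (ℤ.[1+m]⊖[1+n]≡m⊖n m n) ⟩
    fromℤ′ (m ℤ.⊖ n)                      ≈⟨ ⊖-homo m n ⟩
    fromℕ′ m - fromℕ′ n                   ≈⟨ cancel _ _ ⟨
    (1# + fromℕ′ m) - (1# + fromℕ′ n)     ≈⟨ +-cong (1+× m 1#) (-‿cong (1+× n 1#)) ⟨
    fromℕ′ (suc m) - fromℕ′ (suc n)       ∎

  neg-homo : ∀ i → fromℤ′ (ℤ.- i) ≈ - fromℤ′ i
  neg-homo (+ zero)  = sym -0#≈0#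
  neg-homo (+ suc n) = refl
  neg-homo -[1+ n ]  = sym (-‿involutive _)

  +-homo : ∀ i j → fromℤ′ (i ℤ.+ j) ≈ fromℤ′ i + fromℤ′ j
  +-homo (+ m)    (+ n)    = ×-homo-+ 1# m n
  +-homo (+ m)    -[1+ n ] = ⊖-homo m (suc n)
  +-homo -[1+ m ] (+ n)    = trans (⊖-homo n (suc m)) (+-comm _ _)
  +-homo -[1+ m ] -[1+ n ] = begin
    - fromℕ′ (suc (suc (m ℕ.+ n)))           ≈⟨ -‿cong (1+× (suc (m ℕ.+ n)) 1#) ⟩
    - (1# + fromℕ′ (suc m ℕ.+ n))            ≈⟨ -‿cong (+-congˡ (×-homo-+ 1# (suc m) n)) ⟩
    - (1# + (fromℕ′ (suc m) + fromℕ′ n))     ≈⟨ -‿cong (trans (sym (+-assoc _ _ _)) (trans (+-congʳ (+-comm _ _)) (+-assoc _ _ _))) ⟩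
    - (fromℕ′ (suc m) + (1# + fromℕ′ n))     ≈⟨ -‿cong (+-congˡ (1+× n 1#)) ⟨
    - (fromℕ′ (suc m) + fromℕ′ (suc n))      ≈⟨ -‿+-comm _ _ ⟨
    - fromℕ′ (suc m) - fromℕ′ (suc n)        ∎

  private
    pos-homo : ∀ m n → fromℤ′ (+ m ℤ.* + n) ≈ fromℕ′ m * fromℕ′ n
    pos-homo m n = trans (reflexive (≡.cong fromℤ′ (≡.sym (ℤ.pos-* m n)))) (×1-homo-* m n)

  *-homo : ∀ i j → fromℤ′ (i ℤ.* j) ≈ fromℤ′ i * fromℤ′ j
  *-homo (+ m)    (+ n)    = pos-homo m n
  *-homo (+ m)    -[1+ n ] = begin
    fromℤ′ (+ m ℤ.* -[1+ n ])              ≡⟨ ≡.cong fromℤ′ (ℤ.neg-distribʳ-* (+ m) (+ suc n)) ⟨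
    fromℤ′ (ℤ.- (+ m ℤ.* + suc n))         ≈⟨ neg-homo (+ m ℤ.* + suc n) ⟩
    - fromℤ′ (+ m ℤ.* + suc n)             ≈⟨ -‿cong (pos-homo m (suc n)) ⟩
    - (fromℕ′ m * fromℕ′ (suc n))          ≈⟨ -‿distribʳ-* _ _ ⟩
    fromℕ′ m * - fromℕ′ (suc n)            ∎
  *-homo -[1+ m ] (+ n) = begin
    fromℤ′ (-[1+ m ] ℤ.* + n)              ≡⟨ ≡.cong fromℤ′ (ℤ.neg-distribˡ-* (+ suc m) (+ n)) ⟨
    fromℤ′ (ℤ.- (+ suc m ℤ.* + n))         ≈⟨ neg-homo (+ suc m ℤ.* + n) ⟩
    - fromℤ′ (+ suc m ℤ.* + n)             ≈⟨ -‿cong (pos-homo (suc m) n) ⟩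
    - (fromℕ′ (suc m) * fromℕ′ n)          ≈⟨ -‿distribˡ-* _ _ ⟩
    - fromℕ′ (suc m) * fromℕ′ n            ∎
  *-homo -[1+ m ] -[1+ n ] = begin
    fromℤ′ (+ suc m ℤ.* + suc n)           ≈⟨ pos-homo (suc m) (suc n) ⟩
    fromℕ′ (suc m) * fromℕ′ (suc n)        ≈⟨ -‿involutive _ ⟨
    - - (fromℕ′ (suc m) * fromℕ′ (suc n))  ≈⟨ -‿cong (-‿distribˡ-* _ _) ⟩
    - (- fromℕ′ (suc m) * fromℕ′ (suc n))  ≈⟨ -‿distribʳ-* _ _ ⟩
    - fromℕ′ (suc m) * - fromℕ′ (suc n)    ∎

  private
    ℤ-rawRing : RawRing _ _
    ℤ-rawRing = CommutativeRing.rawRing ℤ.+-*-commutativeRing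

    homomorphism : ℤ-rawRing -Raw-AlmostCommutative⟶ fromCommutativeRing R
    homomorphism = record
      { ⟦_⟧    = fromℤ′
      ; +-homo = +-homo
      ; *-homo = *-homo
      ; -‿homo = neg-homo
      ; 0-homo = refl
      ; 1-homo = refl
      }

    coefficient≟ : ∀ i j → Maybe (fromℤ′ i ≈ fromℤ′ j)
    coefficient≟ i j with i ℤ.≟ j
    ... | yes i≡j = just (reflexive (≡.cong fromℤ′ i≡j))
    ... | no  _   = nothing

  open RingSolver ℤ-rawRing (fromCommutativeRing R) homomorphism coefficient≟ public
    using (solve; _:=_; _:+_; _:*_; _:-_; :-_; con)

-- Linear algebra over a commutative ring

module LinearAlgebra {c ℓ} (R : CommutativeRing c ℓ) where

  open CommutativeRing R hiding (zero)
  open Sum semiring public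
    using (sum; sum-cong-≋; sum-remove; ∑-comm; ∑-distrib-+; *-distribˡ-sum; *-distribʳ-sum; sum-replicate-zero)
  open IntegerMultiples R
  open SetoidReasoning setoid

  infix 8 _∙_

  _∙_ : ∀ {n} → Vector Carrier n → Vector Carrier n → Carrier
  x ∙ y = sum λ i → x i * y i

  sum-zero : ∀ {n} {x : Vector Carrier n} → (∀ i → x i ≈ 0#) → sum x ≈ 0#
  sum-zero {n} x≈0 = trans (sum-cong-≋ x≈0) (sum-replicate-zero n)

  ∙-comm : ∀ {n} (x y : Vector Carrier n) → x ∙ y ≈ y ∙ x
  ∙-comm x y = sum-cong-≋ λ i → *-comm (x i) (y i)

  ∙-congˡ : ∀ {n} {x y z : Vector Carrier n} → (∀ i → y i ≈ z i) → x ∙ y ≈ x ∙ z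
  ∙-congˡ y≈z = sum-cong-≋ λ i → *-congˡ (y≈z i)

  ∙-congʳ : ∀ {n} {x y z : Vector Carrier n} → (∀ i → y i ≈ z i) → y ∙ x ≈ z ∙ x
  ∙-congʳ y≈z = sum-cong-≋ λ i → *-congʳ (y≈z i)

  ∙-zeroˡ : ∀ {n} {x y : Vector Carrier n} → (∀ i → x i ≈ 0#) → x ∙ y ≈ 0#
  ∙-zeroˡ x≈0 = sum-zero λ i → trans (*-congʳ (x≈0 i)) (zeroˡ _)

  ∙-zeroʳ : ∀ {n} {x y : Vector Carrier n} → (∀ i → y i ≈ 0#) → x ∙ y ≈ 0#
  ∙-zeroʳ y≈0 = sum-zero λ i → trans (*-congˡ (y≈0 i)) (zeroʳ _)

  ∙-linearʳ : ∀ {n} (x y z : Vector Carrier n) a → x ∙ (λ i → y i + a * z i) ≈ x ∙ y + a * (x ∙ z)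
  ∙-linearʳ x y z a = begin
    x ∙ (λ i → y i + a * z i)                          ≈⟨ sum-cong-≋ (λ i → solve 4 (λ x y z a → x :* (y :+ a :* z) := x :* y :+ a :* (x :* z)) refl (x i) (y i) (z i) a) ⟩
    sum (λ i → x i * y i + a * (x i * z i))            ≈⟨ ∑-distrib-+ (λ i → x i * y i) (λ i → a * (x i * z i)) ⟩
    x ∙ y + sum (λ i → a * (x i * z i))                ≈⟨ +-congˡ (*-distribˡ-sum a (λ i → x i * z i)) ⟨
    x ∙ y + a * (x ∙ z)                                ∎

  ∙-linearˡ : ∀ {n} (x y z : Vector Carrier n) a → (λ i → x i + a * y i) ∙ z ≈ x ∙ z + a * (y ∙ z)
  ∙-linearˡ x y z a = begin
    (λ i → x i + a * y i) ∙ z       ≈⟨ ∙-comm _ z ⟩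
    z ∙ (λ i → x i + a * y i)       ≈⟨ ∙-linearʳ z x y a ⟩
    z ∙ x + a * (z ∙ y)             ≈⟨ +-cong (∙-comm z x) (*-congˡ (∙-comm z y)) ⟩
    x ∙ z + a * (y ∙ z)             ∎

  ∙-assoc : ∀ {m n} (x : Vector Carrier m) (A : Fin m → Fin n → Carrier) (y : Vector Carrier n) →
            x ∙ (λ i → A i ∙ y) ≈ (λ j → x ∙ (λ i → A i j)) ∙ y
  ∙-assoc x A y = begin
    x ∙ (λ i → A i ∙ y)                                ≈⟨ sum-cong-≋ (λ i → *-distribˡ-sum (x i) (λ j → A i j * y j)) ⟩
    sum (λ i → sum (λ j → x i * (A i j * y j)))        ≈⟨ ∑-comm (λ i j → x i * (A i j * y j)) ⟩
    sum (λ j → sum (λ i → x i * (A i j * y j)))        ≈⟨ sum-cong-≋ (λ j → sum-cong-≋ λ i → *-assoc (x i) (A i j) (y j)) ⟨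
    sum (λ j → sum (λ i → x i * A i j * y j))          ≈⟨ sum-cong-≋ (λ j → *-distribʳ-sum (y j) (λ i → x i * A i j)) ⟨
    (λ j → x ∙ (λ i → A i j)) ∙ y                      ∎

  ∙-swap : ∀ {m n} (x : Vector Carrier n) (y : Vector Carrier m) (p : Fin m → Vector Carrier n) →
           x ∙ (λ j → y ∙ (λ i → p i j)) ≈ y ∙ (λ i → x ∙ p i)
  ∙-swap x y p = begin
    x ∙ (λ j → y ∙ (λ i → p i j))    ≈⟨ ∙-comm x _ ⟩
    (λ j → y ∙ (λ i → p i j)) ∙ x    ≈⟨ ∙-assoc y p x ⟨
    y ∙ (λ i → p i ∙ x)              ≈⟨ ∙-congˡ {x = y} (λ i → ∙-comm (p i) x) ⟩
    y ∙ (λ i → x ∙ p i)              ∎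

  single : ∀ {n} → Fin n → Carrier → Vector Carrier n
  single zero    x = x ∷ λ _ → 0#
  single (suc j) x = 0# ∷ single j x

  single-∙ : ∀ {n} (j : Fin n) x (y : Vector Carrier n) → single j x ∙ y ≈ x * y j
  single-∙ {suc n} zero x y = begin
    x * y zero + (λ _ → 0#) ∙ (y ∘ suc)  ≈⟨ +-congˡ (∙-zeroˡ {x = λ _ → 0#} {y = y ∘ suc} λ _ → refl) ⟩
    x * y zero + 0#                      ≈⟨ +-identityʳ _ ⟩
    x * y zero                           ∎
  single-∙ {suc n} (suc j) x y = begin
    0# * y zero + single j x ∙ (y ∘ suc)  ≈⟨ +-cong (zeroˡ _) (single-∙ j x (y ∘ suc)) ⟩
    0# + x * y (suc j)                    ≈⟨ +-identityˡ _ ⟩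
    x * y (suc j)                         ∎

  Independent : ∀ {m n} → (Fin m → Vector Carrier n) → Set _
  Independent {m} {n} p = ∀ μ → (∀ j → μ ∙ (λ i → p i j) ≈ 0#) → ∀ i → μ i ≈ 0#

  InSpan : ∀ {m n} → (Fin m → Vector Carrier n) → Vector Carrier n → Set _
  InSpan {m} b w = ∃[ μ ] ∀ j → w j ≈ μ ∙ (λ (i : Fin m) → b i j)

  module _
    (nontrivial : ¬ 1# ≈ 0#)
    (*-nonzero  : ∀ {x y} → ¬ x ≈ 0# → ¬ y ≈ 0# → ¬ x * y ≈ 0#)
    where

    -- Fraction-free elimination, so that it applies over ℤ as well.
    dependent : ∀ {m r} → r ℕ.< m → (p : Fin m → Vector Carrier r) →
                ¬ ¬ (∃[ μ ] (∀ j → μ ∙ (λ i → p i j) ≈ 0#) × ∃[ i ] ¬ μ i ≈ 0#)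
    dependent {suc m} {zero}  r<m       p = pure ((λ _ → 1#) , (λ ()) , zero , nontrivial)
    dependent {suc m} {suc r} (s≤s r<m) p = do
      yes (k , pₖ≉0) ← em {A = ∃[ k ] ¬ p k zero ≈ 0#}
        where
          no ¬pivot → do
            zeros ← ¬¬-∀ {P = λ k → p k zero ≈ 0#} λ k pₖ≉0 → ¬pivot (k , pₖ≉0)
            (μ , μp≈0 , i , μᵢ≉0) ← dependent r<m (λ i j → p (suc i) (suc j))
            pure ( 0# ∷ μ
                 , ∀-cons (∙-zeroʳ {x = 0# ∷ μ} zeros)
                          (λ j → trans (+-cong (zeroˡ _) (μp≈0 j)) (+-identityˡ 0#))
                 , suc i , μᵢ≉0)
      -- The minors with the pivot row have zero first column, so a dependency of their other
      -- columns is one of all columns. Scaling by the pivot, and giving row k the coefficient that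
      -- clears the first column, turns it into a dependency of p.
      let minor : Fin m → Vector Carrier (suc r)
          minor i j = p k zero * p (punchIn k i) j - p (punchIn k i) zero * p k j
      (ν , νp≈0 , i , νᵢ≉0) ← dependent r<m (λ i j → minor i (suc j))
      let ν′ : Vector Carrier m
          ν′ i = ν i * p k zero
          μₖ = - (ν ∙ (λ i → p (punchIn k i) zero))
          μ = insertAt ν′ k μₖ
          column : ∀ j → μ ∙ (λ i → p i j) ≈ ν ∙ (λ i → minor i j)
          column j = begin
            μ ∙ (λ i → p i j)
              ≈⟨ sum-remove {i = k} (λ i → μ i * p i j) ⟩
            μ k * p k j + sum (λ i → μ (punchIn k i) * p (punchIn k i) j)
              ≈⟨ +-cong (*-congʳ (reflexive (insertAt-lookup ν′ k μₖ)))
                        (sum-cong-≋ λ i → *-congʳ (reflexive (insertAt-punchIn ν′ k μₖ i))) ⟩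
            μₖ * p k j + sum (λ i → ν i * p k zero * p (punchIn k i) j)
              ≈⟨ solve 3 (λ s q t → :- s :* q :+ t := t :+ :- q :* s) refl _ (p k j) _ ⟩
            sum (λ i → ν i * p k zero * p (punchIn k i) j) + - p k j * (ν ∙ (λ i → p (punchIn k i) zero))
              ≈⟨ +-congʳ (sum-cong-≋ {m} λ i → *-assoc (ν i) _ _) ⟩
            ν ∙ (λ i → p k zero * p (punchIn k i) j) + - p k j * (ν ∙ (λ i → p (punchIn k i) zero))
              ≈⟨ ∙-linearʳ ν (λ i → p k zero * p (punchIn k i) j) (λ i → p (punchIn k i) zero) (- p k j) ⟨
            ν ∙ (λ i → p k zero * p (punchIn k i) j + - p k j * p (punchIn k i) zero)
              ≈⟨ ∙-congˡ {x = ν} (λ i → solve 3 (λ x a b → x :+ :- a :* b := x :- b :* a) refl _ (p k j) _) ⟩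
            ν ∙ (λ i → minor i j) ∎
      pure ( μ
           , ∀-cons (trans (column zero) (∙-zeroʳ {x = ν} λ i → solve 2 (λ a b → a :* b :- b :* a := con (+ 0)) refl _ _))
                    (λ j → trans (column (suc j)) (νp≈0 j))
           , punchIn k i
           , λ μ≈0 → *-nonzero νᵢ≉0 pₖ≉0 (trans (reflexive (≡.sym (insertAt-punchIn ν′ k μₖ i))) μ≈0))

    -- If r < m, the m coefficient vectors of length r are dependent, and their dependency is one of
    -- the `p i`.
    independent⇒≤ : ∀ {m r n} {b : Fin r → Vector Carrier n} {p : Fin m → Vector Carrier n} →
                    (∀ i → InSpan b (p i)) → Independent p → ¬ ¬ (m ℕ.≤ r)
    independent⇒≤ {m} {r} {b = b} {p} spans indep m≰r =
      dependent (ℕ.≰⇒> m≰r) (λ i → proj₁ (spans i)) λ (μ , μc≈0 , i , μᵢ≉0) →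
        μᵢ≉0 (indep μ (λ j → begin
          μ ∙ (λ i → p i j)                                        ≈⟨ ∙-congˡ {x = μ} (λ i → proj₂ (spans i) j) ⟩
          μ ∙ (λ i → proj₁ (spans i) ∙ (λ l → b l j))              ≈⟨ ∙-assoc μ (λ i → proj₁ (spans i)) (λ l → b l j) ⟩
          (λ l → μ ∙ (λ i → proj₁ (spans i) l)) ∙ (λ l → b l j)    ≈⟨ ∙-zeroˡ μc≈0 ⟩
          0#                                                       ∎) i)

-- The ordered field of real numbers inside double negation

module OrderedField {c ℓ₁ ℓ₂} (ℝ : Reals c ℓ₁ ℓ₂) where

  open Reals ℝ hiding (zero; sum)
  open RingProperties (CommutativeRing.ring commutativeRing) using (-0#≈0#)
  open IntegerMultiples commutativeRing
  open LinearAlgebra commutativeRing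
  open SetoidReasoning setoid
  private module < = IsStrictPartialOrder isStrictPartialOrder

  -- Equality is the negation of apartness, so an equation proved inside ¬ ¬ can be taken out again.
  ≈-stable : ∀ {x y} → ¬ ¬ x ≈ y → x ≈ y
  ≈-stable {x} {y} ¬x≉y = proj₁ (tight x y) λ x#y → ¬x≉y λ x≈y → proj₂ (tight x y) x≈y x#y

  -- Inverses come from apartness, which a number merely unequal to zero satisfies only inside ¬ ¬.
  inverse : ∀ {x} → ¬ x ≈ 0# → ¬ ¬ (∃[ y ] x * y ≈ 1#)
  inverse {x} x≉0 k = x≉0 (proj₁ (tight x 0#) λ x#0 →
    let (y , _ , [x-0]y≈1) = #⇒invertible x#0 in
    k (y , trans (*-congʳ (sym (trans (+-congˡ -0#≈0#) (+-identityʳ x)))) [x-0]y≈1))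

  x-y≈0⇒y≈x : ∀ {x y} → x - y ≈ 0# → y ≈ x
  x-y≈0⇒y≈x {x} {y} x-y≈0 = begin
    y            ≈⟨ solve 2 (λ x y → y := x :- (x :- y)) refl x y ⟩
    x - (x - y)  ≈⟨ +-congˡ (trans (-‿cong x-y≈0) -0#≈0#) ⟩
    x + 0#       ≈⟨ +-identityʳ x ⟩
    x            ∎

  1≉0 : ¬ 1# ≈ 0#
  1≉0 1≈0 = <.irrefl (sym 1≈0) 0<1

  *-nonzero : ∀ {x y} → ¬ x ≈ 0# → ¬ y ≈ 0# → ¬ x * y ≈ 0#
  *-nonzero {x} {y} x≉0 y≉0 xy≈0 = inverse x≉0 λ (z , xz≈1) → y≉0 (begin
    y            ≈⟨ *-identityˡ y ⟨
    1# * y       ≈⟨ *-congʳ xz≈1 ⟨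
    x * z * y    ≈⟨ solve 3 (λ x y z → x :* z :* y := x :* y :* z) refl x y z ⟩
    x * y * z    ≈⟨ *-congʳ xy≈0 ⟩
    0# * z       ≈⟨ zeroˡ z ⟩
    0#           ∎)

  *-cancelˡ-0 : ∀ {x y} → ¬ x ≈ 0# → x * y ≈ 0# → y ≈ 0#
  *-cancelˡ-0 x≉0 xy≈0 = ≈-stable λ y≉0 → *-nonzero x≉0 y≉0 xy≈0

  compare : ∀ x y → ¬ ¬ (x < y ⊎ x ≈ y ⊎ y < x)
  compare x y k = k (inj₂ (inj₁ (proj₁ (tight x y) λ x#y →
    [ k ∘ inj₁ , k ∘ inj₂ ∘ inj₂ ]′ (#⇒<⊎> x#y))))

  <⇒≤ : ∀ {x y} → x < y → x ≤ y
  <⇒≤ x<y y<x = <.irrefl refl (<.trans x<y y<x)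

  ≤-respʳ-≈ : ∀ {x y z} → y ≈ z → x ≤ y → x ≤ z
  ≤-respʳ-≈ y≈z x≤y z<x = x≤y (<.<-respˡ-≈ (sym y≈z) z<x)

  ≤-respˡ-≈ : ∀ {x y z} → x ≈ y → x ≤ z → y ≤ z
  ≤-respˡ-≈ x≈y x≤z z<y = x≤z (<.<-respʳ-≈ (sym x≈y) z<y)

  0≤0 : 0# ≤ 0#
  0≤0 = <.irrefl refl

  ≈⇒≤ : ∀ {x y} → x ≈ y → x ≤ y
  ≈⇒≤ x≈y y<x = <.irrefl (sym x≈y) y<x

  <⇒0<- : ∀ {x y} → x < y → 0# < y - x
  <⇒0<- {x} {y} x<y = <.<-respˡ-≈ (-‿inverseʳ x) (+-monoˡ-< (- x) x<y)

  0<-⇒< : ∀ {x y} → 0# < y - x → x < y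
  0<-⇒< {x} {y} 0<y-x = <.<-respˡ-≈ (+-identityˡ x)
    (<.<-respʳ-≈ (solve 2 (λ x y → y :- x :+ x := y) refl x y) (+-monoˡ-< x 0<y-x))

  ≤⇒0≤- : ∀ {x y} → x ≤ y → 0# ≤ y - x
  ≤⇒0≤- {x} {y} x≤y y-x<0 = x≤y (0<-⇒< (<.<-respʳ-≈
    (solve 2 (λ x y → con (+ 0) :- (y :- x) := x :- y) refl x y) (<⇒0<- y-x<0)))

  0≤-⇒≤ : ∀ {x y} → 0# ≤ y - x → x ≤ y
  0≤-⇒≤ {x} {y} 0≤y-x y<x = 0≤y-x (0<-⇒< (<.<-respʳ-≈
    (solve 2 (λ x y → x :- y := con (+ 0) :- (y :- x)) refl x y) (<⇒0<- y<x)))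

  0<-+ : ∀ {x y} → 0# < x → 0# < y → 0# < x + y
  0<-+ {x} {y} 0<x 0<y = <.trans 0<y (<.<-respˡ-≈ (+-identityˡ y) (+-monoˡ-< y 0<x))

  0≤-cases : ∀ {x} → 0# ≤ x → ¬ ¬ (0# < x ⊎ x ≈ 0#)
  0≤-cases {x} 0≤x = do
    inj₂ (inj₁ x≈0) ← compare 0# x
      where
        inj₁ 0<x → pure (inj₁ 0<x)
        inj₂ (inj₂ x<0) → contradiction x<0 0≤x
    pure (inj₂ (sym x≈0))

  0≤-+ : ∀ {x y} → 0# ≤ x → 0# ≤ y → 0# ≤ x + y
  0≤-+ {x} {y} 0≤x 0≤y x+y<0 = 0≤-cases 0≤x λ where
    (inj₂ x≈0) → 0≤y (<.<-respˡ-≈ (trans (+-congʳ x≈0) (+-identityˡ y)) x+y<0)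
    (inj₁ 0<x) → 0≤-cases 0≤y λ where
      (inj₂ y≈0) → 0≤x (<.<-respˡ-≈ (trans (+-congˡ y≈0) (+-identityʳ x)) x+y<0)
      (inj₁ 0<y) → <⇒≤ (0<-+ 0<x 0<y) x+y<0

  0≤-* : ∀ {x y} → 0# ≤ x → 0# ≤ y → 0# ≤ x * y
  0≤-* {x} {y} 0≤x 0≤y xy<0 = 0≤-cases 0≤x λ where
    (inj₂ x≈0) → <.irrefl (trans (*-congʳ x≈0) (zeroˡ y)) xy<0
    (inj₁ 0<x) → 0≤-cases 0≤y λ where
      (inj₂ y≈0) → <.irrefl (trans (*-congˡ y≈0) (zeroʳ x)) xy<0
      (inj₁ 0<y) → <⇒≤ (*-positive 0<x 0<y) xy<0

  0≤-single : ∀ {n} (i : Fin n) {x} → 0# ≤ x → ∀ j → 0# ≤ single i x j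
  0≤-single zero    0≤x = ∀-cons 0≤x λ _ → 0≤0
  0≤-single (suc i) 0≤x = ∀-cons 0≤0 (0≤-single i 0≤x)

  0≤-sum : ∀ {n} {x : Vector Carrier n} → (∀ i → 0# ≤ x i) → 0# ≤ sum x
  0≤-sum {zero}  0≤x = 0≤0
  0≤-sum {suc n} 0≤x = 0≤-+ (0≤x zero) (0≤-sum (0≤x ∘ suc))

  0≤-∙ : ∀ {n} {x y : Vector Carrier n} → (∀ i → 0# ≤ x i) → (∀ i → 0# ≤ y i) → 0# ≤ x ∙ y
  0≤-∙ 0≤x 0≤y = 0≤-sum λ i → 0≤-* (0≤x i) (0≤y i)

  0≤-total : ∀ x → ¬ ¬ (0# ≤ x ⊎ 0# ≤ - x)
  0≤-total x k = k (inj₁ λ x<0 → k (inj₂ (≤-respʳ-≈ (+-identityˡ (- x)) (<⇒≤ (<⇒0<- x<0)))))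

  0≤-antisym : ∀ {x} → 0# ≤ x → 0# ≤ - x → x ≈ 0#
  0≤-antisym {x} 0≤x 0≤-x = ≈-stable λ x≉0 → 0≤-cases 0≤x λ where
    (inj₂ x≈0) → x≉0 x≈0
    (inj₁ 0<x) → 0≤-x (0<-⇒< (<.<-respʳ-≈
      (solve 1 (λ x → x := con (+ 0) :- :- x) refl x) 0<x))

  0≤-inverse : ∀ {x y} → 0# ≤ x → x * y ≈ 1# → 0# ≤ y
  0≤-inverse {x} {y} 0≤x xy≈1 y<0 = 0≤-* 0≤x (≤-respʳ-≈ (+-identityˡ (- y)) (<⇒≤ (<⇒0<- y<0)))
    (0<-⇒< (<.<-respʳ-≈ (begin
      1#                    ≈⟨ xy≈1 ⟨
      x * y                 ≈⟨ solve 2 (λ x y → x :* y := con (+ 0) :- x :* :- y) refl x y ⟩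
      0# - x * - y          ∎) 0<1))

  sum≈0⇒≈0 : ∀ {n} {x : Vector Carrier n} → (∀ i → 0# ≤ x i) → sum x ≈ 0# → ∀ i → x i ≈ 0#
  sum≈0⇒≈0 {suc n} {x} 0≤x Σx≈0 = ∀-cons x₀≈0 (sum≈0⇒≈0 (0≤x ∘ suc) Σ≈0)
    where
    x₀≈0 : x zero ≈ 0#
    x₀≈0 = 0≤-antisym (0≤x zero) (≤-respʳ-≈ (begin
      sum (x ∘ suc)                      ≈⟨ solve 2 (λ x s → s := x :+ s :- x) refl (x zero) _ ⟩
      x zero + sum (x ∘ suc) - x zero    ≈⟨ +-congʳ Σx≈0 ⟩
      0# - x zero                        ≈⟨ +-identityˡ _ ⟩
      - x zero                           ∎) (0≤-sum (0≤x ∘ suc)))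
    Σ≈0 : sum (x ∘ suc) ≈ 0#
    Σ≈0 = trans (sym (trans (+-congʳ x₀≈0) (+-identityˡ _))) Σx≈0

  MinimalRatio : ∀ {n} → Vector Carrier n → Vector Carrier n → Set _
  MinimalRatio x y = ∃[ t ] ∃[ i ] ¬ y i ≈ 0# × x i ≈ t * y i × (∀ j → 0# ≤ x j - t * y j)

  -- The ratio test of linear programming: t is the least `x i / y i` over the nonzero `y i`, hence
  -- the largest t for which x - t y stays nonnegative. It may be negative. At zeros of y the value
  -- of t has no influence, and there the sign of x is assumed.
  minimal-ratio : ∀ {n} (x y : Vector Carrier n) → (∀ i → 0# ≤ y i) → (∀ i → y i ≈ 0# → 0# ≤ x i) →
                  ¬ ¬ ((∀ i → y i ≈ 0#) ⊎ MinimalRatio x y)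
  minimal-ratio {zero}  x y 0≤y 0≤x = pure (inj₁ λ ())
  minimal-ratio {suc n} x y 0≤y 0≤x = do
    ih ← minimal-ratio (x ∘ suc) (y ∘ suc) (0≤y ∘ suc) (0≤x ∘ suc)
    yes y₀≈0 ← em {A = y zero ≈ 0#}
      where
        no y₀≉0 → do
          (z , y₀z≈1) ← inverse y₀≉0
          let r = x zero * z
              x₀≈ry₀ : x zero ≈ r * y zero
              x₀≈ry₀ = begin
                x zero                     ≈⟨ *-identityʳ _ ⟨
                x zero * 1#                ≈⟨ *-congˡ y₀z≈1 ⟨
                x zero * (y zero * z)      ≈⟨ solve 3 (λ x y z → x :* (y :* z) := x :* z :* y) refl _ _ _ ⟩
                r * y zero                 ∎
              head≥0 : 0# ≤ x zero - r * y zero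
              head≥0 = ≈⇒≤ (sym (trans (+-congʳ x₀≈ry₀) (-‿inverseʳ _)))
          case-tail x₀≈ry₀ head≥0 y₀≉0 ih
    pure ([ (λ zeros → inj₁ (∀-cons y₀≈0 zeros))
          , (λ (t , i , yᵢ≉0 , xᵢ≈tyᵢ , bounds) → inj₂ (t , suc i , yᵢ≉0 , xᵢ≈tyᵢ ,
              ∀-cons (≤-respʳ-≈ (sym (trans (+-congˡ (trans (-‿cong (trans (*-congˡ y₀≈0) (zeroʳ t))) -0#≈0#)) (+-identityʳ _))) (0≤x zero y₀≈0)) bounds)) ]′ ih)
    where
    weaken : ∀ {s t} i → 0# ≤ t - s → 0# ≤ x i - t * y i → 0# ≤ x i - s * y i
    weaken {s} {t} i s≤t bound = ≤-respʳ-≈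
      (solve 4 (λ x y s t → x :- t :* y :+ (t :- s) :* y := x :- s :* y) refl (x i) (y i) s t)
      (0≤-+ bound (0≤-* s≤t (0≤y i)))
    case-tail : ∀ {r} → x zero ≈ r * y zero → 0# ≤ x zero - r * y zero → ¬ y zero ≈ 0# →
                (∀ i → y (suc i) ≈ 0#) ⊎ MinimalRatio (x ∘ suc) (y ∘ suc) → ¬ ¬ ((∀ i → y i ≈ 0#) ⊎ MinimalRatio x y)
    case-tail {r} x₀≈ry₀ head≥0 y₀≉0 (inj₁ zeros) = pure (inj₂ (r , zero , y₀≉0 , x₀≈ry₀ ,
      ∀-cons head≥0 λ i → ≤-respʳ-≈ (sym (trans (+-congˡ (trans (-‿cong (trans (*-congˡ (zeros i)) (zeroʳ r))) -0#≈0#)) (+-identityʳ _)))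
        (0≤x (suc i) (zeros i))))
    case-tail {r} x₀≈ry₀ head≥0 y₀≉0 (inj₂ (t , i , yᵢ≉0 , xᵢ≈tyᵢ , bounds)) = do
      inj₁ r≤t ← 0≤-total (t - r)
        where
          inj₂ t≤r → pure (inj₂ (t , suc i , yᵢ≉0 , xᵢ≈tyᵢ ,
            ∀-cons (weaken zero (≤-respʳ-≈ (solve 2 (λ r t → :- (t :- r) := r :- t) refl r t) t≤r) head≥0) bounds))
      pure (inj₂ (r , zero , y₀≉0 , x₀≈ry₀ , ∀-cons head≥0 λ j → weaken (suc j) r≤t (bounds j)))

  -- Linear systems over a subfield, and bases chosen from a family

  record IsSubfield {k} (K : Carrier → Set k) : Set (c ⊔ ℓ₁ ⊔ k) where
    field
      ∈-resp    : ∀ {x y} → x ≈ y → K x → K y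
      0∈        : K 0#
      +∈        : ∀ {x y} → K x → K y → K (x + y)
      *∈        : ∀ {x y} → K x → K y → K (x * y)
      -∈        : ∀ {x} → K x → K (- x)
      inverse∈  : ∀ {x y} → K x → x * y ≈ 1# → K y

    sum∈ : ∀ {n} {x : Vector Carrier n} → (∀ i → K (x i)) → K (sum x)
    sum∈ {zero}  x∈ = 0∈
    sum∈ {suc n} x∈ = +∈ (x∈ zero) (sum∈ (x∈ ∘ suc))

    ∙∈ : ∀ {n} {x y : Vector Carrier n} → (∀ i → K (x i)) → (∀ i → K (y i)) → K (x ∙ y)
    ∙∈ x∈ y∈ = sum∈ λ i → *∈ (x∈ i) (y∈ i)

    single∈ : ∀ {n} (j : Fin n) {x} → K x → ∀ i → K (single j x i)
    single∈ zero    x∈ = ∀-cons x∈ λ _ → 0∈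
    single∈ (suc j) x∈ = ∀-cons 0∈ (single∈ j x∈)

  module _ {k} {K : Carrier → Set k} (isSubfield : IsSubfield K) where
    open IsSubfield isSubfield

    -- The Fredholm alternative with both certificates in K. A real solution of the system excludes
    -- the second certificate, so a system over K that is solvable over ℝ is solvable over K. The
    -- induction first compares `b zero` with the other vectors: it is either redundant or isolated
    -- by a functional v.
    separate : ∀ {r n} (b : Fin r → Vector Carrier n) (w : Vector Carrier n) →
      (∀ i j → K (b i j)) → (∀ j → K (w j)) →
      ¬ ¬ ((∃[ μ ] (∀ i → K (μ i)) × (∀ j → w j ≈ μ ∙ (λ i → b i j)))
         ⊎ (∃[ u ] (∀ j → K (u j)) × (∀ i → u ∙ b i ≈ 0#) × u ∙ w ≈ 1#))
    separate {zero} b w b∈ w∈ = do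
      yes (j , wⱼ≉0) ← em {A = ∃[ j ] ¬ w j ≈ 0#}
        where no w≈0 → pure (inj₁ ((λ ()) , (λ ()) , λ j → ≈-stable λ wⱼ≉0 → w≈0 (j , wⱼ≉0)))
      (z , wⱼz≈1) ← inverse wⱼ≉0
      pure (inj₂ (single j z , single∈ j (inverse∈ (w∈ j) wⱼz≈1) , (λ ())
                 , trans (single-∙ j z w) (trans (*-comm z (w j)) wⱼz≈1)))
    separate {suc r} b w b∈ w∈ = do
      inj₂ (v , v∈ , vb≈0 , vb₀≈1) ← separate (b ∘ suc) (b zero) (b∈ ∘ suc) (b∈ zero)
        where
          inj₁ (ν , ν∈ , b₀≈νb) → do
            inj₂ (u , u∈ , ub≈0 , uw≈1) ← separate (b ∘ suc) w (b∈ ∘ suc) w∈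
              where
                inj₁ (μ , μ∈ , w≈μb) → pure (inj₁ (0# ∷ μ , ∀-cons 0∈ μ∈ ,
                  λ j → trans (w≈μb j) (sym (trans (+-congʳ (zeroˡ _)) (+-identityˡ _)))))
            pure (inj₂ (u , u∈ , ∀-cons (begin
              u ∙ b zero                               ≈⟨ ∙-congˡ {x = u} b₀≈νb ⟩
              u ∙ (λ j → ν ∙ (λ i → b (suc i) j))      ≈⟨ ∙-swap u ν (b ∘ suc) ⟩
              ν ∙ (λ i → u ∙ b (suc i))                ≈⟨ ∙-zeroʳ {x = ν} ub≈0 ⟩
              0#                                       ∎) ub≈0 , uw≈1))
      -- As v is 1 at `b zero` and 0 at the other vectors, `b zero` can only occur in w with
      -- coefficient a.
      let a = v ∙ w
          a∈ = ∙∈ v∈ w∈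
      inj₂ (u , u∈ , ub≈0 , uw≈1) ← separate (b ∘ suc) (λ j → w j + - a * b zero j) (b∈ ∘ suc)
                                             (λ j → +∈ (w∈ j) (*∈ (-∈ a∈) (b∈ zero j)))
        where
          inj₁ (μ , μ∈ , w≈μb) → pure (inj₁ (a ∷ μ , ∀-cons a∈ μ∈ , λ j → begin
            w j                                          ≈⟨ solve 3 (λ w a b → w := a :* b :+ (w :+ :- a :* b)) refl (w j) a (b zero j) ⟩
            a * b zero j + (w j + - a * b zero j)        ≈⟨ +-congˡ (w≈μb j) ⟩
            a * b zero j + μ ∙ (λ i → b (suc i) j)       ∎))
      -- Subtracting d v makes u vanish at `b zero` too. The value at w becomes u w - d a, which is
      -- the value of u at w - a `b zero`, that is 1.
      let d = u ∙ b zero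
          d∈ = ∙∈ u∈ (b∈ zero)
      pure (inj₂
        ( (λ j → u j + - d * v j)
        , (λ j → +∈ (u∈ j) (*∈ (-∈ d∈) (v∈ j)))
        , ∀-cons (begin
            (λ j → u j + - d * v j) ∙ b zero     ≈⟨ ∙-linearˡ u v (b zero) (- d) ⟩
            d + - d * (v ∙ b zero)               ≈⟨ +-congˡ (trans (*-congˡ vb₀≈1) (*-identityʳ _)) ⟩
            d - d                                ≈⟨ -‿inverseʳ d ⟩
            0#                                   ∎)
          (λ i → begin
            (λ j → u j + - d * v j) ∙ b (suc i)       ≈⟨ ∙-linearˡ u v (b (suc i)) (- d) ⟩
            u ∙ b (suc i) + - d * (v ∙ b (suc i))     ≈⟨ +-cong (ub≈0 i) (trans (*-congˡ (vb≈0 i)) (zeroʳ _)) ⟩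
            0# + 0#                                   ≈⟨ +-identityˡ 0# ⟩
            0#                                        ∎)
        , (begin
            (λ j → u j + - d * v j) ∙ w               ≈⟨ ∙-linearˡ u v w (- d) ⟩
            u ∙ w + - d * a                           ≈⟨ solve 3 (λ x d a → x :+ :- d :* a := x :+ :- a :* d) refl _ d a ⟩
            u ∙ w + - a * d                           ≈⟨ ∙-linearʳ u w (b zero) (- a) ⟨
            u ∙ (λ j → w j + - a * b zero j)          ≈⟨ uw≈1 ⟩
            1#                                        ∎)))

  everything : IsSubfield (λ _ → ⊤)
  everything = record
    { ∈-resp = _ ; 0∈ = _ ; +∈ = _ ; *∈ = _ ; -∈ = _ ; inverse∈ = _ }

  inSpan? : ∀ {r n} (b : Fin r → Vector Carrier n) w →
            ¬ ¬ (InSpan b w ⊎ (∃[ u ] (∀ i → u ∙ b i ≈ 0#) × u ∙ w ≈ 1#))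
  inSpan? b w = do
    inj₁ (μ , _ , w≈μb) ← separate everything b w _ _
      where inj₂ (u , _ , ub≈0 , uw≈1) → pure (inj₂ (u , ub≈0 , uw≈1))
    pure (inj₁ (μ , w≈μb))

  -- Applying u to a relation leaves only the term of `p zero`, whose coefficient must therefore
  -- vanish.
  independent-suc : ∀ {r n} {p : Fin (suc r) → Vector Carrier n} {u} → Independent (p ∘ suc) →
                    (∀ i → u ∙ p (suc i) ≈ 0#) → ¬ u ∙ p zero ≈ 0# → Independent p
  independent-suc {p = p} {u} indep up≈0 up₀≉0 μ μp≈0 = ∀-cons μ₀≈0 (indep (μ ∘ suc) λ j → begin
    (μ ∘ suc) ∙ (λ i → p (suc i) j)                       ≈⟨ +-identityˡ _ ⟨
    0# + (μ ∘ suc) ∙ (λ i → p (suc i) j)                  ≈⟨ +-congʳ (trans (*-congʳ μ₀≈0) (zeroˡ _)) ⟨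
    μ ∙ (λ i → p i j)                                     ≈⟨ μp≈0 j ⟩
    0#                                                    ∎)
    where
    μ₀≈0 : μ zero ≈ 0#
    μ₀≈0 = *-cancelˡ-0 up₀≉0 (begin
      u ∙ p zero * μ zero                                       ≈⟨ *-comm _ _ ⟩
      μ zero * (u ∙ p zero)                                     ≈⟨ +-identityʳ _ ⟨
      μ zero * (u ∙ p zero) + 0#                                ≈⟨ +-congˡ (∙-zeroʳ {x = μ ∘ suc} up≈0) ⟨
      μ ∙ (λ i → u ∙ p i)                                       ≈⟨ ∙-swap u μ p ⟨
      u ∙ (λ j → μ ∙ (λ i → p i j))                             ≈⟨ ∙-zeroʳ {x = u} μp≈0 ⟩
      0#                                                        ∎)

  -- A basis of the span of those `p i` with `D i`, given by indices; `rest` lists all other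
  -- indices, including those outside D. It is used for the generators at which a functional
  -- vanishes and, with D always true, for the functions on Q.
  record Basis {m n d} (p : Fin m → Vector Carrier n) (D : Fin m → Set d) : Set (c ⊔ ℓ₁ ⊔ d) where
    field
      {rank corank}  : ℕ
      basis          : Fin rank → Fin m
      rest           : Fin corank → Fin m
      rank+corank    : rank ℕ.+ corank ≡ m
      basis∈         : ∀ l → D (basis l)
      basis⊎rest     : ∀ i → (∃[ l ] basis l ≡ i) ⊎ (∃[ l ] rest l ≡ i)
      independent    : Independent (p ∘ basis)
      spanning       : ∀ i → D i → InSpan (p ∘ basis) (p i)

  chooseBasis : ∀ {m n d} (p : Fin m → Vector Carrier n) {D : Fin m → Set d} → (∀ i → Dec (D i)) → ¬ ¬ Basis p D
  chooseBasis {zero} p D? = pure record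
    { rank = 0 ; corank = 0 ; basis = λ () ; rest = λ () ; rank+corank = ≡.refl ; basis∈ = λ () ; basis⊎rest = λ ()
    ; independent = λ _ _ () ; spanning = λ () }
  chooseBasis {suc m} p {D} D? = do
    B ← chooseBasis (p ∘ suc) (D? ∘ suc)
    s ← inSpan? (p ∘ suc ∘ Basis.basis B) (p zero)
    extend B (D? zero) s
    where
    skip : (B : Basis (p ∘ suc) (D ∘ suc)) → (D zero → InSpan (p ∘ suc ∘ Basis.basis B) (p zero)) → Basis p D
    skip B p₀∈span = record
      { basis = suc ∘ basis ; rest = zero ∷ suc ∘ rest
      ; rank+corank = ≡.trans (ℕ.+-suc _ _) (≡.cong suc rank+corank)
      ; basis∈ = basis∈
      ; basis⊎rest = ∀-cons (inj₂ (zero , ≡.refl)) λ i →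
          [ (λ { (l , ≡.refl) → inj₁ (l , ≡.refl) }) , (λ { (l , ≡.refl) → inj₂ (suc l , ≡.refl) }) ]′ (basis⊎rest i)
      ; independent = independent
      ; spanning = ∀-cons p₀∈span spanning }
      where open Basis B
    extend : (B : Basis (p ∘ suc) (D ∘ suc)) → Dec (D zero) →
             InSpan (p ∘ suc ∘ Basis.basis B) (p zero) ⊎ (∃[ u ] (∀ i → u ∙ p (suc (Basis.basis B i)) ≈ 0#) × u ∙ p zero ≈ 1#) → ¬ ¬ Basis p D
    extend B D₀?      (inj₁ p₀∈span) = pure (skip B λ _ → p₀∈span)
    extend B (no ¬D₀) (inj₂ _)       = pure (skip B λ D₀ → contradiction D₀ ¬D₀)
    extend B (yes D₀) (inj₂ (u , ub≈0 , up₀≈1)) = pure record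
      { basis = zero ∷ suc ∘ basis ; rest = suc ∘ rest
      ; rank+corank = ≡.cong suc rank+corank
      ; basis∈ = ∀-cons D₀ basis∈
      ; basis⊎rest = ∀-cons (inj₁ (zero , ≡.refl)) λ i →
          [ (λ { (l , ≡.refl) → inj₁ (suc l , ≡.refl) }) , (λ { (l , ≡.refl) → inj₂ (l , ≡.refl) }) ]′ (basis⊎rest i)
      ; independent = independent-suc {p = p ∘ (zero ∷ suc ∘ basis)} {u} independent ub≈0 (λ up₀≈0 → 1≉0 (trans (sym up₀≈1) up₀≈0))
      ; spanning = ∀-cons
          (λ _ → (1# ∷ λ _ → 0#) , λ j → sym (trans (+-cong (*-identityˡ _) (∙-zeroˡ {x = λ _ → 0#} {y = λ l → p (suc (basis l)) j} λ _ → refl)) (+-identityʳ _)))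
          λ i Dᵢ → let (μ , pᵢ≈μb) = spanning i Dᵢ in
            (0# ∷ μ) , λ j → trans (pᵢ≈μb j) (sym (trans (+-congʳ (zeroˡ _)) (+-identityˡ _))) }
      where open Basis B

-- Counting monomials

^-distribʳ-* : ∀ m i j → (i ℕ.* j) ℕ.^ m ≡ i ℕ.^ m ℕ.* j ℕ.^ m
^-distribʳ-* zero    i j = ≡.refl
^-distribʳ-* (suc m) i j = ≡.trans (≡.cong (i ℕ.* j ℕ.*_) (^-distribʳ-* m i j))
  (ℕ.[m*n]*[o*p]≡[m*o]*[n*p] i j (i ℕ.^ m) (j ℕ.^ m))

∃-bound : ∀ {n} (D : Fin n → ℕ) → ∃[ B ] ∀ i → D i ℕ.≤ B
∃-bound {zero}  D = 0 , λ ()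
∃-bound {suc n} D = let (B , D≤B) = ∃-bound (D ∘ suc) in
  D zero ℕ.+ B , ∀-cons (ℕ.m≤m+n _ B) λ i → ℕ.≤-trans (D≤B i) (ℕ.m≤n+m B _)

-- The left side counts the monomials of degree at most n s B in each of m parameters,
-- the right side those of degree below s in each of n elements.
more-monomials : ∀ m n B → m ℕ.< n → let s = suc (suc (n ℕ.* B) ℕ.^ m) in
                 suc (n ℕ.* (s ℕ.* B)) ℕ.^ m ℕ.< s ℕ.^ n
more-monomials m n B m<n = begin-strict
  suc (n ℕ.* (s ℕ.* B)) ℕ.^ m              ≤⟨ ℕ.^-monoˡ-≤ m degree≤ ⟩
  (s ℕ.* suc (n ℕ.* B)) ℕ.^ m              ≡⟨ ^-distribʳ-* m s (suc (n ℕ.* B)) ⟩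
  -- The choice of s as one more than `suc (n * B) ^ m` gives the strict inequality; the extra
  -- factor s is available because m + 1 ≤ n.
  s ℕ.^ m ℕ.* suc (n ℕ.* B) ℕ.^ m          <⟨ ℕ.*-monoʳ-< (s ℕ.^ m) {{ℕ.m^n≢0 s m}} (ℕ.n<1+n _) ⟩
  s ℕ.^ m ℕ.* s                            ≡⟨ ℕ.*-comm (s ℕ.^ m) s ⟩
  s ℕ.^ suc m                              ≤⟨ ℕ.^-monoʳ-≤ s m<n ⟩
  s ℕ.^ n                                  ∎
  where
  open ℕ.≤-Reasoning
  s = suc (suc (n ℕ.* B) ℕ.^ m)
  degree≤ : suc (n ℕ.* (s ℕ.* B)) ℕ.≤ s ℕ.* suc (n ℕ.* B)
  degree≤ = begin
    suc (n ℕ.* (s ℕ.* B))        ≤⟨ ℕ.+-monoˡ-≤ _ (s≤s z≤n) ⟩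
    s ℕ.+ n ℕ.* (s ℕ.* B)        ≡⟨ ≡.cong (s ℕ.+_) (≡.trans (≡.sym (ℕ.*-assoc n s B)) (≡.trans (≡.cong (ℕ._* B) (ℕ.*-comm n s)) (ℕ.*-assoc s n B))) ⟩
    s ℕ.+ s ℕ.* (n ℕ.* B)        ≡⟨ ℕ.*-suc s (n ℕ.* B) ⟨
    s ℕ.* suc (n ℕ.* B)          ∎

-- Algebraic dependence of rational functions in fewer parameters

module Transcendence {c ℓ₁ ℓ₂} (ℝ : Reals c ℓ₁ ℓ₂) where

  open Polytopes ℝ hiding (zero; sum; _∙_)
  open OrderedField ℝ
  open IntegerMultiples commutativeRing
  open LinearAlgebra commutativeRing
  open SetoidReasoning setoid
  open Exp (CommutativeRing.semiring commutativeRing) using (^-homo-*)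
  private
    module Π = CommutativeMonoidSum (CommutativeRing.*-commutativeMonoid commutativeRing)
    module ℤ-Linear = LinearAlgebra ℤ.+-*-commutativeRing

  fromℤ≈fromℤ′ : ∀ z → fromℤ z ≈ fromℤ′ z
  fromℤ≈fromℤ′ (+ n)    = MonoidMult′.×ᵤ≈× (CommutativeRing.+-monoid commutativeRing) n 1#
  fromℤ≈fromℤ′ -[1+ n ] = -‿cong (MonoidMult′.×ᵤ≈× (CommutativeRing.+-monoid commutativeRing) (suc n) 1#)

  fromℤ′-∙ : ∀ {n} (x y : Vector ℤ n) → fromℤ′ (ℤ-Linear._∙_ x y) ≈ (fromℤ′ ∘ x) ∙ (fromℤ′ ∘ y)
  fromℤ′-∙ {zero}  x y = refl
  fromℤ′-∙ {suc n} x y = trans (+-homo (x zero ℤ.* y zero) _)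
    (+-cong (*-homo (x zero) (y zero)) (fromℤ′-∙ (x ∘ suc) (y ∘ suc)))

  fromℤ′-single : ∀ {n} (j : Fin n) z i → fromℤ′ (ℤ-Linear.single j z i) ≈ single j (fromℤ′ z) i
  fromℤ′-single zero    z = ∀-cons refl λ _ → refl
  fromℤ′-single (suc j) z = ∀-cons refl (fromℤ′-single j z)

  integer : ℤ → ℚ
  integer z = mkℚ z 0 (ℕ.sym (ℕ.1-coprimeTo _))

  fromℚ-integer : ∀ z → fromℚ (integer z) ≈ fromℤ′ z
  fromℚ-integer z = begin
    fromℤ z * 1/fromℕ[1+ 0 ]  ≈⟨ *-cong (fromℤ≈fromℤ′ z) 1/1≈1 ⟩
    fromℤ′ z * 1#             ≈⟨ *-identityʳ _ ⟩
    fromℤ′ z                  ∎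
    where
    1/1≈1 : 1/fromℕ[1+ 0 ] ≈ 1#
    1/1≈1 = begin
      -- This inverse is known only through its product with `fromℕ 1 - 0#`, which equals `1#` but
      -- does not compute to it.
      1/fromℕ[1+ 0 ]                     ≈⟨ solve 2 (λ i y → y := i :* y :+ (con (+ 1) :- i) :* y) refl (fromℕ 1 - 0#) _ ⟩
      (fromℕ 1 - 0#) * 1/fromℕ[1+ 0 ] + (1# - (fromℕ 1 - 0#)) * 1/fromℕ[1+ 0 ]
                                         ≈⟨ +-cong (proj₂ (proj₂ (#⇒invertible {fromℕ 1} {0#} _))) (trans (*-congʳ 1-[1-0]≈0) (zeroˡ _)) ⟩
      1# + 0#                            ≈⟨ +-identityʳ 1# ⟩
      1#                                 ∎
      where
      1-[1-0]≈0 : 1# - (fromℕ 1 - 0#) ≈ 0#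
      1-[1-0]≈0 = solve 0 (con (+ 1) :- ((con (+ 1) :+ con (+ 0)) :- con (+ 0)) := con (+ 0)) refl

  monomial : ∀ {m} → Vector Carrier m → (Fin m → ℕ) → Carrier
  monomial t a = product λ i → t i ^ a i

  monomial-* : ∀ {m} (t : Vector Carrier m) a b → monomial t a * monomial t b ≈ monomial t (λ i → a i ℕ.+ b i)
  monomial-* t a b = begin
    monomial t a * monomial t b              ≈⟨ Π.∑-distrib-+ (λ i → t i ^ a i) (λ i → t i ^ b i) ⟨
    product (λ i → t i ^ a i * t i ^ b i)    ≈⟨ Π.sum-cong-≋ (λ i → ^-homo-* (t i) (a i) (b i)) ⟨
    monomial t (λ i → a i ℕ.+ b i)           ∎

  monomial-zero : ∀ {m} (t : Vector Carrier m) → monomial t (λ _ → 0) ≈ 1#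
  monomial-zero {zero}  t = refl
  monomial-zero {suc m} t = trans (*-identityˡ _) (monomial-zero (t ∘ suc))

  product-nonzero : ∀ {n} {x : Vector Carrier n} → (∀ i → ¬ x i ≈ 0#) → ¬ product x ≈ 0#
  product-nonzero {zero}  x≉0 = 1≉0
  product-nonzero {suc n} x≉0 = *-nonzero (x≉0 zero) (product-nonzero (x≉0 ∘ suc))

  ^-nonzero : ∀ {x} n → ¬ x ≈ 0# → ¬ x ^ n ≈ 0#
  ^-nonzero zero    x≉0 = 1≉0
  ^-nonzero (suc n) x≉0 = *-nonzero x≉0 (^-nonzero n x≉0)

  module _ {m} (t : Vector Carrier m) where

    -- The values at t of integer polynomials of degree at most D in each variable.
    data Value (D : ℕ) : Carrier → Set (c ⊔ ℓ₁) where
      monomial∈ : ∀ a → (∀ i → a i ℕ.≤ D) → Value D (monomial t a)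
      zero∈     : Value D 0#
      add∈      : ∀ {x y} → Value D x → Value D y → Value D (x + y)
      neg∈      : ∀ {x} → Value D x → Value D (- x)
      resp∈     : ∀ {x y} → x ≈ y → Value D x → Value D y

    Value-mono : ∀ {D E x} → D ℕ.≤ E → Value D x → Value E x
    Value-mono D≤E (monomial∈ a a≤D) = monomial∈ a λ i → ℕ.≤-trans (a≤D i) D≤E
    Value-mono D≤E zero∈             = zero∈
    Value-mono D≤E (add∈ x y)        = add∈ (Value-mono D≤E x) (Value-mono D≤E y)
    Value-mono D≤E (neg∈ x)          = neg∈ (Value-mono D≤E x)
    Value-mono D≤E (resp∈ x≈y x)     = resp∈ x≈y (Value-mono D≤E x)

    one∈ : ∀ {D} → Value D 1#
    one∈ = resp∈ (monomial-zero t) (monomial∈ (λ _ → 0) λ _ → z≤n)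

    var∈ : ∀ i → Value 1 (t i)
    var∈ i = resp∈ (variable-monomial m t i) (monomial∈ (indicator i) (indicator≤1 i))
      where
      indicator : ∀ {m} → Fin m → Fin m → ℕ
      indicator zero    = 1 ∷ λ _ → 0
      indicator (suc i) = 0 ∷ indicator i
      indicator≤1 : ∀ {m} (i j : Fin m) → indicator i j ℕ.≤ 1
      indicator≤1 zero    = ∀-cons ℕ.≤-refl λ _ → z≤n
      indicator≤1 (suc i) = ∀-cons z≤n (indicator≤1 i)
      variable-monomial : ∀ m (t : Vector Carrier m) i → monomial t (indicator i) ≈ t i
      variable-monomial (suc m) t zero    = trans (*-cong (*-identityʳ _) (monomial-zero (t ∘ suc))) (*-identityʳ _)
      variable-monomial (suc m) t (suc i) = trans (*-identityˡ _) (variable-monomial m (t ∘ suc) i)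

    -- Distributivity reduces the product to products of two monomials, where degrees add.
    mul∈ : ∀ {D E x y} → Value D x → Value E y → Value (D ℕ.+ E) (x * y)
    mul∈ (monomial∈ a a≤D) (monomial∈ b b≤E) =
      resp∈ (sym (monomial-* t a b)) (monomial∈ _ λ i → ℕ.+-mono-≤ (a≤D i) (b≤E i))
    mul∈ x@(monomial∈ _ _) zero∈         = resp∈ (sym (zeroʳ _)) zero∈
    mul∈ x@(monomial∈ _ _) (add∈ y z)    = resp∈ (sym (distribˡ _ _ _)) (add∈ (mul∈ x y) (mul∈ x z))
    mul∈ x@(monomial∈ _ _) (neg∈ y)      = resp∈ (solve 2 (λ x y → :- (x :* y) := x :* :- y) refl _ _) (neg∈ (mul∈ x y))
    mul∈ x@(monomial∈ _ _) (resp∈ y≈z y) = resp∈ (*-congˡ y≈z) (mul∈ x y)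
    mul∈ zero∈         y = resp∈ (sym (zeroˡ _)) zero∈
    mul∈ (add∈ w x)    y = resp∈ (sym (distribʳ _ _ _)) (add∈ (mul∈ w y) (mul∈ x y))
    mul∈ (neg∈ x)      y = resp∈ (solve 2 (λ x y → :- (x :* y) := :- x :* y) refl _ _) (neg∈ (mul∈ x y))
    mul∈ (resp∈ w≈x w) y = resp∈ (*-congʳ w≈x) (mul∈ w y)

    product∈ : ∀ {n D} {x : Vector Carrier n} → (∀ i → Value D (x i)) → Value (n ℕ.* D) (product x)
    product∈ {zero}  x∈ = one∈
    product∈ {suc n} x∈ = mul∈ (x∈ zero) (product∈ (x∈ ∘ suc))

    dimension : ℕ → ℕ
    dimension D = suc D ℕ.^ m

    basisMonomial : ∀ D → Vector Carrier (dimension D)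
    basisMonomial D j = monomial t (toℕ ∘ finToFun {suc D} {m} j)

    -- The coefficients are read off the derivation. The value x does not determine them, since
    -- distinct monomials may satisfy linear relations at t.
    coefficients : ∀ {D x} → Value D x → ∃[ κ ] x ≈ (fromℤ′ ∘ κ) ∙ basisMonomial D
    coefficients {D} (monomial∈ a a≤D) = ℤ-Linear.single j (+ 1) , (begin
      monomial t a                                               ≈⟨ Π.sum-cong-≋ (λ i → reflexive (≡.cong (t i ^_) (≡.sym (exponent≡ i)))) ⟩
      basisMonomial D j                                          ≈⟨ *-identityˡ _ ⟨
      1# * basisMonomial D j                                     ≈⟨ single-∙ j 1# (basisMonomial D) ⟨
      single j 1# ∙ basisMonomial D                              ≈⟨ ∙-congʳ (fromℤ′-single j (+ 1)) ⟨
      (fromℤ′ ∘ ℤ-Linear.single j (+ 1)) ∙ basisMonomial D       ∎)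
      where
      digit : Fin m → Fin (suc D)
      digit i = fromℕ< (s≤s (a≤D i))
      j = funToFin digit
      exponent≡ : ∀ i → toℕ (finToFun {suc D} {m} j i) ≡ a i
      exponent≡ i = ≡.trans (≡.cong toℕ (finToFun-funToFin digit i)) (toℕ-fromℕ< (s≤s (a≤D i)))
    coefficients {D} zero∈ = (λ _ → + 0) , sym (∙-zeroˡ {x = λ _ → 0#} {y = basisMonomial D} λ _ → refl)
    coefficients {D} (add∈ {x} {y} x∈ y∈) =
      let (κ , x≈) = coefficients x∈ ; (λ′ , y≈) = coefficients y∈ in
      (λ j → κ j ℤ.+ λ′ j) , (begin
      x + y
        ≈⟨ +-cong x≈ y≈ ⟩
      (fromℤ′ ∘ κ) ∙ basisMonomial D + (fromℤ′ ∘ λ′) ∙ basisMonomial D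
        ≈⟨ ∑-distrib-+ (λ j → fromℤ′ (κ j) * basisMonomial D j) (λ j → fromℤ′ (λ′ j) * basisMonomial D j) ⟨
      sum (λ j → fromℤ′ (κ j) * basisMonomial D j + fromℤ′ (λ′ j) * basisMonomial D j)
        ≈⟨ sum-cong-≋ (λ j → trans (*-congʳ (+-homo (κ j) (λ′ j))) (distribʳ _ _ _)) ⟨
      (λ j → fromℤ′ (κ j ℤ.+ λ′ j)) ∙ basisMonomial D ∎)
    coefficients {D} (neg∈ {x} x∈) =
      let (κ , x≈) = coefficients x∈ in
      (λ j → ℤ.- κ j) , (begin
      - x
        ≈⟨ solve 1 (λ x → :- x := :- con (+ 1) :* x) refl x ⟩
      - 1# * x
        ≈⟨ *-congˡ x≈ ⟩
      - 1# * ((fromℤ′ ∘ κ) ∙ basisMonomial D)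
        ≈⟨ *-distribˡ-sum (- 1#) (λ j → fromℤ′ (κ j) * basisMonomial D j) ⟩
      sum (λ j → - 1# * (fromℤ′ (κ j) * basisMonomial D j))
        ≈⟨ sum-cong-≋ (λ j → trans (solve 2 (λ k y → :- con (+ 1) :* (k :* y) := :- k :* y) refl _ _) (*-congʳ (sym (neg-homo (κ j))))) ⟩
      (λ j → fromℤ′ (ℤ.- κ j)) ∙ basisMonomial D ∎)
    coefficients (resp∈ x≈y x∈) = let (κ , x≈) = coefficients x∈ in κ , trans (sym x≈y) x≈

    -- Membership in ℚ(t), with the denominator multiplied out and one degree bound for both
    -- polynomials.
    record Rational (x : Carrier) : Set (c ⊔ ℓ₁) where
      field
        {degree num den} : _
        num∈  : Value degree num
        den∈  : Value degree den
        den≉0 : ¬ den ≈ 0#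
        ratio : den * x ≈ num

    private
      fraction : ∀ {D E p q x} → Value D p → Value E q → ¬ q ≈ 0# → q * x ≈ p → Rational x
      fraction {D} {E} p q q≉0 qx≈p = record
        { num∈ = Value-mono (ℕ.m≤m+n D E) p ; den∈ = Value-mono (ℕ.m≤n+m E D) q
        ; den≉0 = q≉0 ; ratio = qx≈p }

    rational-resp : ∀ {x y} → x ≈ y → Rational x → Rational y
    rational-resp x≈y x∈ = fraction num∈ den∈ den≉0 (trans (*-congˡ (sym x≈y)) ratio)
      where open Rational x∈

    rational-0 : Rational 0#
    rational-0 = fraction (zero∈ {0}) (one∈ {0}) 1≉0 (zeroʳ 1#)

    rational-1 : Rational 1#
    rational-1 = fraction (one∈ {0}) (one∈ {0}) 1≉0 (*-identityˡ 1#)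

    rational-+ : ∀ {x y} → Rational x → Rational y → Rational (x + y)
    rational-+ {x} {y} x∈ y∈ =
      fraction (add∈ (mul∈ X.num∈ Y.den∈) (mul∈ X.den∈ Y.num∈)) (mul∈ X.den∈ Y.den∈) (*-nonzero X.den≉0 Y.den≉0) (begin
        X.den * Y.den * (x + y)                      ≈⟨ solve 4 (λ p q x y → p :* q :* (x :+ y) := p :* x :* q :+ p :* (q :* y)) refl X.den Y.den x y ⟩
        X.den * x * Y.den + X.den * (Y.den * y)      ≈⟨ +-cong (*-congʳ X.ratio) (*-congˡ Y.ratio) ⟩
        X.num * Y.den + X.den * Y.num                ∎)
      where
      module X = Rational x∈
      module Y = Rational y∈

    rational-* : ∀ {x y} → Rational x → Rational y → Rational (x * y)
    rational-* {x} {y} x∈ y∈ =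
      fraction (mul∈ X.num∈ Y.num∈) (mul∈ X.den∈ Y.den∈) (*-nonzero X.den≉0 Y.den≉0) (begin
        X.den * Y.den * (x * y)      ≈⟨ solve 4 (λ p q x y → p :* q :* (x :* y) := p :* x :* (q :* y)) refl X.den Y.den x y ⟩
        X.den * x * (Y.den * y)      ≈⟨ *-cong X.ratio Y.ratio ⟩
        X.num * Y.num                ∎)
      where
      module X = Rational x∈
      module Y = Rational y∈

    rational-neg : ∀ {x} → Rational x → Rational (- x)
    rational-neg {x} x∈ = fraction (neg∈ num∈) den∈ den≉0
      (trans (solve 2 (λ q x → q :* :- x := :- (q :* x)) refl den x) (-‿cong ratio))
      where open Rational x∈

    rational-inverse : ∀ {x y} → Rational x → x * y ≈ 1# → Rational y
    rational-inverse {x} {y} x∈ xy≈1 =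
      fraction den∈ num∈ (λ num≈0 → den≉0 (trans (sym numy≈den) (trans (*-congʳ num≈0) (zeroˡ y)))) numy≈den
      where
      open Rational x∈
      numy≈den : num * y ≈ den
      numy≈den = begin
        num * y           ≈⟨ *-congʳ ratio ⟨
        den * x * y       ≈⟨ *-assoc den x y ⟩
        den * (x * y)     ≈⟨ *-congˡ xy≈1 ⟩
        den * 1#          ≈⟨ *-identityʳ den ⟩
        den               ∎

    isSubfield : IsSubfield Rational
    isSubfield = record
      { ∈-resp = rational-resp ; 0∈ = rational-0 ; +∈ = rational-+ ; *∈ = rational-*
      ; -∈ = rational-neg ; inverse∈ = rational-inverse }

    variable∈ : ∀ i → Rational (t i)
    variable∈ i = fraction (var∈ i) (one∈ {0}) 1≉0 (*-identityˡ (t i))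

    -- Since a ≤ s, each factor x can be paired with a factor q, and each pair is p; what remains is
    -- a product of s polynomial values of degree at most D.
    clear : ∀ {D p q x} → Value D p → Value D q → q * x ≈ p → ∀ s a → a ℕ.≤ s → Value (s ℕ.* D) (q ^ s * x ^ a)
    clear p∈ q∈ qx≈p zero    zero    z≤n       = resp∈ (sym (*-identityˡ 1#)) one∈
    clear {q = q} {x} p∈ q∈ qx≈p (suc s) zero    z≤n       =
      resp∈ (sym (*-assoc q (q ^ s) 1#)) (mul∈ q∈ (clear p∈ q∈ qx≈p s zero z≤n))
    clear {q = q} {x} p∈ q∈ qx≈p (suc s) (suc a) (s≤s a≤s) =
      resp∈ (solve 4 (λ q x y z → q :* x :* (y :* z) := q :* y :* (x :* z)) refl q x (q ^ s) (x ^ a))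
        (mul∈ (resp∈ (sym qx≈p) p∈) (clear p∈ q∈ qx≈p s a a≤s))

  -- After multiplication by a common denominator, the monomials in x with exponents below s are
  -- values at t of polynomials of bounded degree. By `more-monomials` their integer coefficient
  -- vectors outnumber the available monomials in t, and a dependency over ℤ between these vectors
  -- is a polynomial relation between the x.
  rational⇒dependent : ∀ {m n} (t : Vector Carrier m) (x : Vector Carrier n) → m ℕ.< n →
                       (∀ i → Rational t (x i)) → ¬ AlgebraicallyIndependent x
  rational⇒dependent {m} {n} t x m<n x∈ independent =
    ℤ-Linear.dependent (λ ()) ℤ-nonzero (more-monomials m n B m<n) (λ l → proj₁ (coefficients t (cleared l)))
      λ (μ , μκ≡0 , l , μₗ≢0) → μₗ≢0 (≡.cong ℚ.numerator (independent (polynomial μ) (vanishes μ μκ≡0) l))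
    where
    module X i = Rational (x∈ i)
    B = proj₁ (∃-bound X.degree)
    degree≤B : ∀ i → X.degree i ℕ.≤ B
    degree≤B = proj₂ (∃-bound X.degree)
    s = suc (suc (n ℕ.* B) ℕ.^ m)
    E = n ℕ.* (s ℕ.* B)
    exponents : Fin (s ℕ.^ n) → Fin n → ℕ
    exponents l = toℕ ∘ finToFun {s} {n} l
    -- One denominator for all monomials at once: no exponent exceeds s, so the power s of each
    -- `den` suffices.
    Q = product λ i → X.den i ^ s
    Q≉0 : ¬ Q ≈ 0#
    Q≉0 = product-nonzero λ i → ^-nonzero s (X.den≉0 i)
    cleared : ∀ l → Value t E (Q * monomial x (exponents l))
    cleared l = resp∈ (Π.∑-distrib-+ (λ i → X.den i ^ s) (λ i → x i ^ exponents l i))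
      (product∈ t λ i → clear t (Value-mono t (degree≤B i) (X.num∈ i)) (Value-mono t (degree≤B i) (X.den∈ i)) (X.ratio i)
        s (exponents l i) (ℕ.<⇒≤ (toℕ<n (finToFun {s} {n} l i))))
    ℤ-nonzero : ∀ {i j : ℤ} → ¬ i ≡ + 0 → ¬ j ≡ + 0 → ¬ i ℤ.* j ≡ + 0
    ℤ-nonzero {i} i≢0 j≢0 ij≡0 = [ i≢0 , j≢0 ]′ (ℤ.i*j≡0⇒i≡0∨j≡0 i ij≡0)
    polynomial : Vector ℤ (s ℕ.^ n) → Polynomial n
    polynomial μ = record
      { exponent = exponents
      ; distinct = λ {k} {l} k≗l → ≡.trans (≡.sym (funToFin-finToFin {n} {s} k)) (≡.trans
          (funToFin-cong λ i → toℕ-injective (k≗l i)) (funToFin-finToFin {n} {s} l))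
      ; coeff    = integer ∘ μ }
      where
      funToFin-cong : ∀ {m n} {f g : Fin m → Fin n} → f ≗ g → funToFin f ≡ funToFin g
      funToFin-cong {zero}  f≗g = ≡.refl
      funToFin-cong {suc m} f≗g = ≡.cong₂ combine (f≗g zero) (funToFin-cong (f≗g ∘ suc))
    vanishes : ∀ μ → _ → eval (polynomial μ) x ≈ 0#
    vanishes μ μκ≡0 = *-cancelˡ-0 Q≉0 (begin
      Q * sum (λ l → fromℚ (integer (μ l)) * P l)
        ≈⟨ *-distribˡ-sum Q (λ l → fromℚ (integer (μ l)) * P l) ⟩
      sum (λ l → Q * (fromℚ (integer (μ l)) * P l))
        ≈⟨ sum-cong-≋ (λ l → trans (*-congˡ (*-congʳ (fromℚ-integer (μ l)))) (solve 3 (λ q u p → q :* (u :* p) := u :* (q :* p)) refl Q _ _)) ⟩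
      (fromℤ′ ∘ μ) ∙ (λ l → Q * P l)
        ≈⟨ ∙-congˡ {x = fromℤ′ ∘ μ} (λ l → proj₂ (coefficients t (cleared l))) ⟩
      (fromℤ′ ∘ μ) ∙ (λ l → (fromℤ′ ∘ κ l) ∙ basisMonomial t E)
        ≈⟨ ∙-assoc (fromℤ′ ∘ μ) (λ l → fromℤ′ ∘ κ l) (basisMonomial t E) ⟩
      (λ j → (fromℤ′ ∘ μ) ∙ (λ l → fromℤ′ (κ l j))) ∙ basisMonomial t E
        ≈⟨ ∙-zeroˡ (λ j → trans (sym (fromℤ′-∙ μ (λ l → κ l j))) (reflexive (≡.cong fromℤ′ (μκ≡0 j)))) ⟩
      0# ∎)
      where
      P : Fin (s ℕ.^ n) → Carrier
      P l = monomial x (exponents l)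
      κ : ∀ l → Vector ℤ (dimension t E)
      κ l = proj₁ (coefficients t (cleared l))

-- Facet slacks generate the nonnegative affine functions on a polytope

module Facets {c ℓ₁ ℓ₂} (ℝ : Reals c ℓ₁ ℓ₂) where

  open Polytopes ℝ hiding (zero; sum; _∙_)
  open OrderedField ℝ
  open RingProperties (CommutativeRing.ring commutativeRing) using (-‿involutive)
  open IntegerMultiples commutativeRing
  open LinearAlgebra commutativeRing
  open SetoidReasoning setoid

  infix 9 _̂

  -- Homogenisation: affine functions become linear functionals on the vectors `x ̂`, and affine
  -- independence becomes linear independence.
  _̂ : ∀ {d} → Point d → Vector Carrier (suc d)
  x ̂ = 1# ∷ x

  affine : ∀ {d} → Point d → Carrier → Vector Carrier (suc d)
  affine a b = b ∷ λ j → - a j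

  affine-∙ : ∀ {d} (a : Point d) b x → affine a b ∙ x ̂ ≈ b - a ∙ x
  affine-∙ a b x = +-cong (*-identityʳ b) (begin
    (λ j → - a j) ∙ x                ≈⟨ sum-cong-≋ (λ j → solve 2 (λ a x → :- a :* x := :- con (+ 1) :* (a :* x)) refl (a j) (x j)) ⟩
    sum (λ j → - 1# * (a j * x j))   ≈⟨ *-distribˡ-sum (- 1#) (λ j → a j * x j) ⟨
    - 1# * (a ∙ x)                   ≈⟨ solve 1 (λ y → :- con (+ 1) :* y := :- y) refl (a ∙ x) ⟩
    - (a ∙ x)                        ∎)

  inSpan-trans : ∀ {m r n} {b : Fin r → Vector Carrier n} {p : Fin m → Vector Carrier n} {x} →
                 (∀ i → InSpan b (p i)) → InSpan p x → InSpan b x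
  inSpan-trans {b = b} {p} {x} p∈ (μ , x≈μp) = (λ l → μ ∙ (λ i → proj₁ (p∈ i) l)) , λ j → begin
    x j                                                       ≈⟨ x≈μp j ⟩
    μ ∙ (λ i → p i j)                                         ≈⟨ ∙-congˡ {x = μ} (λ i → proj₂ (p∈ i) j) ⟩
    μ ∙ (λ i → proj₁ (p∈ i) ∙ (λ l → b l j))                  ≈⟨ ∙-assoc μ (λ i → proj₁ (p∈ i)) (λ l → b l j) ⟩
    (λ l → μ ∙ (λ i → proj₁ (p∈ i) l)) ∙ (λ l → b l j)        ∎

  affinelyIndependent : ∀ {m d} {p : Fin m → Point d} → Independent (_̂ ∘ p) → AffinelyIndependent p
  affinelyIndependent {p = p} indep μ Σμ≈0 μp≈0 = indep μ
    (∀-cons (trans (sum-cong-≋ λ i → *-identityʳ (μ i)) Σμ≈0) μp≈0)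

  affinelyIndependent⁻¹ : ∀ {m d} {p : Fin m → Point d} → AffinelyIndependent p → Independent (_̂ ∘ p)
  affinelyIndependent⁻¹ indep μ μp≈0 = indep μ
    (trans (sum-cong-≋ λ i → sym (*-identityʳ (μ i))) (μp≈0 zero)) (μp≈0 ∘ suc)

  module _ {e} (Q : Polytope e) where

    open Polytope Q renaming (generators to g)

    ĝ : Fin size → Vector Carrier (suc e)
    ĝ i = g i ̂

    generator∈ : ∀ i → g i ∈ ⟦ Q ⟧
    generator∈ i = record
      { weight      = single i 1#
      ; nonNegative = 0≤-single i (<⇒≤ 0<1)
      ; sum≈1       = begin
          sum (single i 1#)           ≈⟨ sum-cong-≋ (λ j → *-identityʳ (single i 1# j)) ⟨
          single i 1# ∙ (λ _ → 1#)    ≈⟨ single-∙ i 1# (λ _ → 1#) ⟩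
          1# * 1#                     ≈⟨ *-identityˡ 1# ⟩
          1#                          ∎
      ; isCombo     = λ j → sym (trans (single-∙ i 1# (λ l → g l j)) (*-identityˡ _))
      }

    module _ {x} (x∈Q : x ∈ ⟦ Q ⟧) where

      open ConvexHull x∈Q

      hull-lift : ∀ j → (x ̂) j ≈ weight ∙ (λ i → ĝ i j)
      hull-lift = ∀-cons (sym (trans (sum-cong-≋ λ i → *-identityʳ (weight i)) sum≈1)) isCombo

      hull-∙ : ∀ F → F ∙ x ̂ ≈ weight ∙ (λ i → F ∙ ĝ i)
      hull-∙ F = trans (∙-congˡ {x = F} hull-lift) (∙-swap F weight ĝ)

      hull-nonNegative : ∀ F → (∀ i → 0# ≤ F ∙ ĝ i) → 0# ≤ F ∙ x ̂
      hull-nonNegative F 0≤F = ≤-respʳ-≈ (sym (hull-∙ F)) (0≤-∙ nonNegative 0≤F)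

    slack : ValidInequality Q → Vector Carrier (suc e)
    slack h = affine normal bound
      where open ValidInequality h

    0≤slack : ∀ h {x} → x ∈ ⟦ Q ⟧ → 0# ≤ slack h ∙ x ̂
    0≤slack h {x} x∈Q = ≤-respʳ-≈ (sym (affine-∙ normal bound x)) (≤⇒0≤- (valid x∈Q))
      where open ValidInequality h

    slack≈0⇒face : ∀ h {x} → x ∈ ⟦ Q ⟧ → slack h ∙ x ̂ ≈ 0# → x ∈ face h
    slack≈0⇒face h {x} x∈Q s≈0 = x∈Q , x-y≈0⇒y≈x (trans (sym (affine-∙ normal bound x)) s≈0)
      where open ValidInequality h

    face⇒slack≈0 : ∀ h {x} → x ∈ face h → slack h ∙ x ̂ ≈ 0#
    face⇒slack≈0 h {x} (_ , n∙x≈b) = trans (affine-∙ normal bound x) (trans (+-congˡ (-‿cong n∙x≈b)) (-‿inverseʳ bound))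
      where open ValidInequality h

    inequality : ∀ F → (∀ i → 0# ≤ F ∙ ĝ i) → ValidInequality Q
    inequality F 0≤F = record
      { normal = λ j → - F (suc j)
      ; bound  = F zero
      ; valid  = λ {x} x∈Q → 0≤-⇒≤ (≤-respʳ-≈ (trans
          (∙-congʳ {x = x ̂} {y = F} {z = affine (λ j → - F (suc j)) (F zero)} (∀-cons refl λ j → sym (-‿involutive (F (suc j)))))
          (affine-∙ (λ j → - F (suc j)) (F zero) x)) (hull-nonNegative x∈Q F 0≤F)) }

    slack-inequality : ∀ F (0≤F : ∀ i → 0# ≤ F ∙ ĝ i) y → slack (inequality F 0≤F) ∙ y ≈ F ∙ y
    slack-inequality F 0≤F y = ∙-congʳ {x = y} {y = slack (inequality F 0≤F)} {z = F} (∀-cons refl λ j → -‿involutive (F (suc j)))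

    module _ (F : Vector Carrier (suc e)) (0≤F : ∀ i → 0# ≤ F ∙ ĝ i)
             {i₀} (Fi₀≉0 : ¬ F ∙ ĝ i₀ ≈ 0#)
             (B : Basis ĝ (λ i → F ∙ ĝ i ≈ 0#))
             (spans : ∀ i → InSpan (ĝ ∘ (i₀ ∷ Basis.basis B)) (ĝ i)) where

      open Basis B

      private
        h = inequality F 0≤F

      -- The generator `g i₀` and a basis of the zeros of F form an affine basis of Q. On the face F
      -- vanishes, which kills the coefficient of `g i₀`, so the zeros alone span it. If Q is a
      -- single point, `rank` is 0 and the face is empty; counting the empty face as a facet makes
      -- this case uniform.
      corank-one⇒facet : IsFacet {Q = Q} h
      corank-one⇒facet = rank , record
        { basis       = g ∘ (i₀ ∷ basis)
        ; basis∈S     = λ l → generator∈ ((i₀ ∷ basis) l)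
        ; independent = affinelyIndependent {p = g ∘ (i₀ ∷ basis)}
            (independent-suc {p = ĝ ∘ (i₀ ∷ basis)} {F} independent basis∈ Fi₀≉0)
        ; maximal     = λ p p∈ indep → decidable-stable (_ ℕ.≤? _) (independent⇒≤ 1≉0 *-nonzero
            {b = ĝ ∘ (i₀ ∷ basis)} {_̂ ∘ p} (λ i → hull-span (p∈ i)) (affinelyIndependent⁻¹ {p = p} indep))
        } , record
        { basis       = g ∘ basis
        ; basis∈S     = λ l → slack≈0⇒face h (generator∈ (basis l)) (trans (slack-inequality F 0≤F (ĝ (basis l))) (basis∈ l))
        ; independent = affinelyIndependent {p = g ∘ basis} independent
        ; maximal     = λ p p∈ indep → decidable-stable (_ ℕ.≤? _) (independent⇒≤ 1≉0 *-nonzero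
            {b = ĝ ∘ basis} {_̂ ∘ p} (λ i → face-span (p∈ i)) (affinelyIndependent⁻¹ {p = p} indep))
        }
        where
        hull-span : ∀ {x} → x ∈ ⟦ Q ⟧ → InSpan (ĝ ∘ (i₀ ∷ basis)) (x ̂)
        hull-span x∈Q = inSpan-trans {b = ĝ ∘ (i₀ ∷ basis)} {ĝ} spans (ConvexHull.weight x∈Q , hull-lift x∈Q)
        face-span : ∀ {x} → x ∈ face h → InSpan (ĝ ∘ basis) (x ̂)
        face-span {x} x∈face with (μ , x≈μb) ← hull-span (proj₁ x∈face) = μ ∘ suc , λ j → begin
          (x ̂) j                                                             ≈⟨ x≈μb j ⟩
          μ zero * ĝ i₀ j + (μ ∘ suc) ∙ (λ l → ĝ (basis l) j)                ≈⟨ +-congʳ (trans (*-congʳ μ₀≈0) (zeroˡ _)) ⟩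
          0# + (μ ∘ suc) ∙ (λ l → ĝ (basis l) j)                             ≈⟨ +-identityˡ _ ⟩
          (μ ∘ suc) ∙ (λ l → ĝ (basis l) j)                                  ∎
          where
          μ₀≈0 : μ zero ≈ 0#
          μ₀≈0 = *-cancelˡ-0 Fi₀≉0 (begin
            F ∙ ĝ i₀ * μ zero                                                ≈⟨ *-comm _ _ ⟩
            μ zero * (F ∙ ĝ i₀)                                              ≈⟨ +-identityʳ _ ⟨
            μ zero * (F ∙ ĝ i₀) + 0#                                         ≈⟨ +-congˡ (∙-zeroʳ {x = μ ∘ suc} basis∈) ⟨
            μ ∙ (λ l → F ∙ ĝ ((i₀ ∷ basis) l))                               ≈⟨ ∙-swap F μ (ĝ ∘ (i₀ ∷ basis)) ⟨
            F ∙ (λ j → μ ∙ (λ l → ĝ ((i₀ ∷ basis) l) j))                     ≈⟨ ∙-congˡ {x = F} x≈μb ⟨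
            F ∙ x ̂                                                           ≈⟨ slack-inequality F 0≤F (x ̂) ⟨
            slack h ∙ x ̂                                                     ≈⟨ face⇒slack≈0 h x∈face ⟩
            0#                                                               ∎)

    module _ {k} (facet : Fin k → ValidInequality Q)
             (complete : ∀ h → IsFacet {Q = Q} h → ∃[ j ] face (facet j) ≐ face h) where

      -- Equality at the generators is equality on Q. Off the affine hull of Q the two functionals
      -- may differ.
      Generated : Vector Carrier (suc e) → Set _
      Generated F = ∃[ μ ] (∀ j → 0# ≤ μ j) × (∀ i → F ∙ ĝ i ≈ μ ∙ (λ j → slack (facet j) ∙ ĝ i))

      Generated-+ : ∀ {F G H t} → 0# ≤ t → (∀ i → F ∙ ĝ i ≈ G ∙ ĝ i + t * (H ∙ ĝ i)) →
                    Generated G → Generated H → Generated F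
      Generated-+ {F} {G} {H} {t} 0≤t F≈G+tH (μ , 0≤μ , G≈) (ν , 0≤ν , H≈) =
        (λ j → μ j + t * ν j) , (λ j → 0≤-+ (0≤μ j) (0≤-* 0≤t (0≤ν j))) , λ i → begin
          F ∙ ĝ i                                                      ≈⟨ F≈G+tH i ⟩
          G ∙ ĝ i + t * (H ∙ ĝ i)                                      ≈⟨ +-cong (G≈ i) (*-congˡ (H≈ i)) ⟩
          μ ∙ (λ j → S j ∙ ĝ i) + t * (ν ∙ (λ j → S j ∙ ĝ i))          ≈⟨ ∙-linearˡ μ ν (λ j → S j ∙ ĝ i) t ⟨
          (λ j → μ j + t * ν j) ∙ (λ j → S j ∙ ĝ i)                    ∎
        where S = slack ∘ facet

      -- The listed facet may be given by another inequality than F. But functionals vanishing on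
      -- the basis of the face are determined on Q by their value at `g i₀`, so F is a nonnegative
      -- multiple of the listed slack.
      sameFace⇒generated : ∀ F (0≤F : ∀ i → 0# ≤ F ∙ ĝ i) {i₀} → ¬ F ∙ ĝ i₀ ≈ 0# →
        (B : Basis ĝ (λ i → F ∙ ĝ i ≈ 0#)) → (∀ i → InSpan (ĝ ∘ (i₀ ∷ Basis.basis B)) (ĝ i)) →
        ∀ j → face (facet j) ≐ face (inequality F 0≤F) → ¬ ¬ Generated F
      sameFace⇒generated F 0≤F {i₀} Fi₀≉0 B spans j (face⊆ , ⊆face) = do
        (z , Si₀z≈1) ← inverse Si₀≉0
        pure ( single j (z * (F ∙ ĝ i₀))
             , 0≤-single j (0≤-* (0≤-inverse (0≤slack (facet j) (generator∈ i₀)) Si₀z≈1) (0≤F i₀))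
             , λ i → proportional i z Si₀z≈1)
        where
        open Basis B
        h = inequality F 0≤F
        S = slack (facet j)
        Sb≈0 : ∀ l → S ∙ ĝ (basis l) ≈ 0#
        Sb≈0 l = face⇒slack≈0 (facet j) (⊆face (slack≈0⇒face h (generator∈ (basis l))
          (trans (slack-inequality F 0≤F (ĝ (basis l))) (basis∈ l))))
        Si₀≉0 : ¬ S ∙ ĝ i₀ ≈ 0#
        Si₀≉0 Si₀≈0 = Fi₀≉0 (trans (sym (slack-inequality F 0≤F (ĝ i₀)))
          (face⇒slack≈0 h (face⊆ (slack≈0⇒face (facet j) (generator∈ i₀) Si₀≈0))))
        at : ∀ G i → (∀ l → G ∙ ĝ (basis l) ≈ 0#) → G ∙ ĝ i ≈ proj₁ (spans i) zero * (G ∙ ĝ i₀)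
        at G i Gb≈0 = let (μ , gᵢ≈μb) = spans i in begin
          G ∙ ĝ i                                                             ≈⟨ ∙-congˡ {x = G} gᵢ≈μb ⟩
          G ∙ (λ j → μ ∙ (λ l → ĝ ((i₀ ∷ basis) l) j))                        ≈⟨ ∙-swap G μ (ĝ ∘ (i₀ ∷ basis)) ⟩
          μ zero * (G ∙ ĝ i₀) + (μ ∘ suc) ∙ (λ l → G ∙ ĝ (basis l))           ≈⟨ +-congˡ (∙-zeroʳ {x = μ ∘ suc} Gb≈0) ⟩
          μ zero * (G ∙ ĝ i₀) + 0#                                            ≈⟨ +-identityʳ _ ⟩
          μ zero * (G ∙ ĝ i₀)                                                 ∎
        rescale : ∀ {f s z} a → s * z ≈ 1# → a * f ≈ z * f * (a * s)
        rescale {f} {s} {z} a sz≈1 = begin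
          a * f                 ≈⟨ *-congˡ (*-identityˡ f) ⟨
          a * (1# * f)          ≈⟨ *-congˡ (*-congʳ sz≈1) ⟨
          a * (s * z * f)       ≈⟨ solve 4 (λ a s z f → a :* (s :* z :* f) := z :* f :* (a :* s)) refl a s z f ⟩
          z * f * (a * s)       ∎
        proportional : ∀ i z → S ∙ ĝ i₀ * z ≈ 1# →
                       F ∙ ĝ i ≈ single j (z * (F ∙ ĝ i₀)) ∙ (λ j → slack (facet j) ∙ ĝ i)
        proportional i z Si₀z≈1 = begin
          F ∙ ĝ i                                                ≈⟨ at F i basis∈ ⟩
          proj₁ (spans i) zero * (F ∙ ĝ i₀)                      ≈⟨ rescale (proj₁ (spans i) zero) Si₀z≈1 ⟩
          z * (F ∙ ĝ i₀) * (proj₁ (spans i) zero * (S ∙ ĝ i₀))   ≈⟨ *-congˡ (at S i Sb≈0) ⟨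
          z * (F ∙ ĝ i₀) * (S ∙ ĝ i)                             ≈⟨ single-∙ j (z * (F ∙ ĝ i₀)) (λ j → slack (facet j) ∙ ĝ i) ⟨
          single j (z * (F ∙ ĝ i₀)) ∙ (λ j → slack (facet j) ∙ ĝ i)    ∎

      facet⇒generated : ∀ F (0≤F : ∀ i → 0# ≤ F ∙ ĝ i) {i₀} → ¬ F ∙ ĝ i₀ ≈ 0# →
        (B : Basis ĝ (λ i → F ∙ ĝ i ≈ 0#)) → (∀ i → InSpan (ĝ ∘ (i₀ ∷ Basis.basis B)) (ĝ i)) → ¬ ¬ Generated F
      facet⇒generated F 0≤F Fi₀≉0 B spans =
        let (j , sameFace) = complete (inequality F 0≤F) (corank-one⇒facet F 0≤F Fi₀≉0 B spans) in
        sameFace⇒generated F 0≤F Fi₀≉0 B spans j sameFace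

      -- The set p only has to contain the generators where F is nonzero, so no decision of equality
      -- enters; its size is the induction measure.
      SupportedOn : Subset size → Vector Carrier (suc e) → Set _
      SupportedOn p F = ∀ i → i Subset.∈ p ⊎ F ∙ ĝ i ≈ 0#

      shrink : ∀ {p F G i} → SupportedOn p F → ¬ F ∙ ĝ i ≈ 0# → (∀ j → F ∙ ĝ j ≈ 0# → G ∙ ĝ j ≈ 0#) → G ∙ ĝ i ≈ 0# →
               SupportedOn (p Subset.- i) G × ∣ p Subset.- i ∣ ℕ.< ∣ p ∣
      shrink {p} {F} {G} {i} supp Fi≉0 F⇒G Gi≈0 = supp′ , Subset.x∈p⇒∣p-x∣<∣p∣ i∈p
        where
        i∈p : i Subset.∈ p
        i∈p = [ (λ i∈p → i∈p) , (λ Fi≈0 → contradiction Fi≈0 Fi≉0) ]′ (supp i)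
        supp′ : SupportedOn (p Subset.- i) G
        supp′ j with j Fin.≟ i | supp j
        ... | yes ≡.refl | _         = inj₂ Gi≈0
        ... | no  j≢i    | inj₁ j∈p  = inj₁ (Subset.x∈p∧x≢y⇒x∈p-y j∈p j≢i)
        ... | no  _      | inj₂ Fj≈0 = inj₂ (F⇒G j Fj≈0)

      -- Unless the zeros of F span a hyperplane, F = G + t H with t ≥ 0 and
      -- with G, H ≥ 0 having strictly more zeros than F.
      nonNegative⇒generated : ∀ n p F → ∣ p ∣ ℕ.≤ n → SupportedOn p F → (∀ i → 0# ≤ F ∙ ĝ i) → ¬ ¬ Generated F
      nonNegative⇒generated n p F ∣p∣≤n supp 0≤F = do
        zero? ← ¬¬-∀ {P = λ i → Dec (F ∙ ĝ i ≈ 0#)} λ i → em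
        B ← chooseBasis ĝ zero?
        yes (i₀ , Fi₀≉0) ← em {A = ∃[ i ] ¬ F ∙ ĝ i ≈ 0#}
          where no F≈0 → pure ((λ _ → 0#) , (λ _ → 0≤0) , λ i →
                  trans (≈-stable λ Fi≉0 → F≈0 (i , Fi≉0)) (sym (∙-zeroˡ {x = λ _ → 0#} {y = λ j → slack (facet j) ∙ ĝ i} λ _ → refl)))
        -- Such a u exists when the zeros of F together with `g i₀` do not span all generators. It
        -- vanishes at the zeros of F and at `g i₀`, but not on Q, and is therefore no multiple of F
        -- on Q.
        yes (i₁ , u , ub≈0 , ui₁≈1) ← em {A = ∃[ i ] ∃[ u ] (∀ l → u ∙ ĝ ((i₀ ∷ Basis.basis B) l) ≈ 0#) × u ∙ ĝ i ≈ 1#}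
          where
            no ¬separated → do
              spans ← ¬¬-∀ λ i → do
                inj₁ i∈span ← inSpan? (ĝ ∘ (i₀ ∷ Basis.basis B)) (ĝ i)
                  where inj₂ separated → contradiction (i , separated) ¬separated
                pure i∈span
              facet⇒generated F 0≤F Fi₀≉0 B spans
        split n ∣p∣≤n B Fi₀≉0 u ub≈0 ui₁≈1
        where
        shift-∙ : ∀ F G t i → (λ j → F j + - t * G j) ∙ ĝ i ≈ F ∙ ĝ i - t * (G ∙ ĝ i)
        shift-∙ F G t i = trans (∙-linearˡ F G (ĝ i) (- t)) (solve 3 (λ x t y → x :+ :- t :* y := x :- t :* y) refl _ t _)
        split : ∀ n → ∣ p ∣ ℕ.≤ n → (B : Basis ĝ (λ i → F ∙ ĝ i ≈ 0#)) → ∀ {i₀ i₁} → ¬ F ∙ ĝ i₀ ≈ 0# →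
                ∀ u → (∀ l → u ∙ ĝ ((i₀ ∷ Basis.basis B) l) ≈ 0#) → u ∙ ĝ i₁ ≈ 1# → ¬ ¬ Generated F
        split n ∣p∣≤n B {i₀} {i₁} Fi₀≉0 u ub≈0 ui₁≈1 = do
          -- Subtract from u the largest multiple of F that keeps it nonnegative. The result H
          -- inherits the zeros of F and gains the zero a.
          inj₂ (s , a , Fa≉0 , ua≈sFa , 0≤H) ← minimal-ratio (λ i → u ∙ ĝ i) (λ i → F ∙ ĝ i) 0≤F (λ i Fi≈0 → ≈⇒≤ (sym (uz≈0 i Fi≈0)))
            where inj₁ F≈0 → contradiction (F≈0 i₀) Fi₀≉0
          let H : Vector Carrier (suc e)
              H j = u j + - s * F j
              H≈ : ∀ i → H ∙ ĝ i ≈ u ∙ ĝ i - s * (F ∙ ĝ i)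
              H≈ = shift-∙ u F s
              0≤H : ∀ i → 0# ≤ H ∙ ĝ i
              0≤H i = ≤-respʳ-≈ (sym (H≈ i)) (0≤H i)
              Hz≈0 : ∀ i → F ∙ ĝ i ≈ 0# → H ∙ ĝ i ≈ 0#
              Hz≈0 i Fi≈0 = trans (H≈ i) (trans (+-cong (uz≈0 i Fi≈0) (-‿cong (trans (*-congˡ Fi≈0) (zeroʳ s)))) (-‿inverseʳ 0#))
              Ha≈0 : H ∙ ĝ a ≈ 0#
              Ha≈0 = trans (H≈ a) (trans (+-congʳ ua≈sFa) (-‿inverseʳ _))
          -- The same with F and H: G = F - t H gains the zero b. H cannot vanish on Q, as then u =
          -- s F; the value at `i₀` would give s = 0, against the value 1 at `i₁`.
          inj₂ (t , b , Hb≉0 , Fb≈tHb , 0≤G) ← minimal-ratio (λ i → F ∙ ĝ i) (λ i → H ∙ ĝ i) 0≤H (λ i _ → 0≤F i)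
            where inj₁ H≈0 → contradiction (u≈0 s λ i → trans (sym (H≈ i)) (H≈0 i)) 1≉0
          let G : Vector Carrier (suc e)
              G j = F j + - t * H j
              G≈ : ∀ i → G ∙ ĝ i ≈ F ∙ ĝ i - t * (H ∙ ĝ i)
              G≈ = shift-∙ F H t
              Gz≈0 : ∀ i → F ∙ ĝ i ≈ 0# → G ∙ ĝ i ≈ 0#
              Gz≈0 i Fi≈0 = trans (G≈ i) (trans (+-cong Fi≈0 (-‿cong (trans (*-congˡ (Hz≈0 i Fi≈0)) (zeroʳ t)))) (-‿inverseʳ 0#))
              Gb≈0 : G ∙ ĝ b ≈ 0#
              Gb≈0 = trans (G≈ b) (trans (+-congʳ Fb≈tHb) (-‿inverseʳ _))
              Fb≉0 : ¬ F ∙ ĝ b ≈ 0#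
              Fb≉0 Fb≈0 = Hb≉0 (Hz≈0 b Fb≈0)
              (suppH , smallerH) = shrink {F = F} {H} supp Fa≉0 Hz≈0 Ha≈0
              (suppG , smallerG) = shrink {F = F} {G} supp Fb≉0 Gz≈0 Gb≈0
          (z , Hbz≈1) ← inverse Hb≉0
          let 0≤t : 0# ≤ t
              0≤t = ≤-respʳ-≈ (begin
                F ∙ ĝ b * z              ≈⟨ *-congʳ Fb≈tHb ⟩
                t * (H ∙ ĝ b) * z        ≈⟨ *-assoc t _ z ⟩
                t * (H ∙ ĝ b * z)        ≈⟨ *-congˡ Hbz≈1 ⟩
                t * 1#                   ≈⟨ *-identityʳ t ⟩
                t                        ∎) (0≤-* (0≤F b) (0≤-inverse (0≤H b) Hbz≈1))
          genG ← recurse n ∣p∣≤n b G smallerG suppG (λ i → ≤-respʳ-≈ (sym (G≈ i)) (0≤G i))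
          genH ← recurse n ∣p∣≤n a H smallerH suppH 0≤H
          pure (Generated-+ {F} {G} {H} 0≤t (λ i → trans
            (solve 3 (λ f t h → f := f :- t :* h :+ t :* h) refl (F ∙ ĝ i) t (H ∙ ĝ i)) (+-congʳ (sym (G≈ i)))) genG genH)
          where
          open Basis B
          uz≈0 : ∀ i → F ∙ ĝ i ≈ 0# → u ∙ ĝ i ≈ 0#
          uz≈0 i Fi≈0 = let (μ , gᵢ≈μb) = spanning i Fi≈0 in begin
            u ∙ ĝ i                                        ≈⟨ ∙-congˡ {x = u} gᵢ≈μb ⟩
            u ∙ (λ j → μ ∙ (λ l → ĝ (basis l) j))          ≈⟨ ∙-swap u μ (ĝ ∘ basis) ⟩
            μ ∙ (λ l → u ∙ ĝ (basis l))                    ≈⟨ ∙-zeroʳ {x = μ} (ub≈0 ∘ suc) ⟩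
            0#                                             ∎
          u≈0 : ∀ s → (∀ i → u ∙ ĝ i - s * (F ∙ ĝ i) ≈ 0#) → 1# ≈ 0#
          u≈0 s u-sF≈0 = begin
            1#                                                         ≈⟨ ui₁≈1 ⟨
            u ∙ ĝ i₁                                                   ≈⟨ u≈sF i₁ ⟩
            s * (F ∙ ĝ i₁)                                             ≈⟨ *-congʳ s≈0 ⟩
            0# * (F ∙ ĝ i₁)                                            ≈⟨ zeroˡ _ ⟩
            0#                                                         ∎
            where
            u≈sF : ∀ i → u ∙ ĝ i ≈ s * (F ∙ ĝ i)
            u≈sF i = trans (solve 2 (λ u f → u := u :- f :+ f) refl _ (s * (F ∙ ĝ i))) (trans (+-congʳ (u-sF≈0 i)) (+-identityˡ _))
            s≈0 : s ≈ 0#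
            s≈0 = *-cancelˡ-0 Fi₀≉0 (trans (*-comm _ s) (trans (sym (u≈sF i₀)) (ub≈0 zero)))
          recurse : ∀ n → ∣ p ∣ ℕ.≤ n → ∀ i G → ∣ p Subset.- i ∣ ℕ.< ∣ p ∣ → SupportedOn (p Subset.- i) G →
                    (∀ i → 0# ≤ G ∙ ĝ i) → ¬ ¬ Generated G
          recurse zero    ∣p∣≤0 i G smaller = contradiction (ℕ.≤-trans smaller ∣p∣≤0) λ ()
          recurse (suc n) ∣p∣≤n i G smaller = nonNegative⇒generated n (p Subset.- i) G (ℕ.≤-pred (ℕ.≤-trans smaller ∣p∣≤n))

concat-combine : ∀ {a} {A : Set a} {m n} (xss : Vector (Vector A m) n) i j → concat xss (combine i j) ≡ xss i j
concat-combine xss i j = ≡.cong (uncurry xss) (remQuot-combine i j)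

-- Extensions, and expansions of the projection over a vertex

module Extensions {c ℓ₁ ℓ₂} (ℝ : Reals c ℓ₁ ℓ₂) where

  open Polytopes ℝ hiding (zero; sum; _∙_)
  open OrderedField ℝ
  open Transcendence ℝ
  open Facets ℝ
  open IntegerMultiples commutativeRing
  open LinearAlgebra commutativeRing
  open SetoidReasoning setoid

  module _ {e d} {π : Point e → Point d} (linear : IsLinear π) where

    open ModuleMorphisms.LeftModuleMorphisms.IsLeftModuleHomomorphism linear

    linear-combination : ∀ {m} (μ : Vector Carrier m) (p : Fin m → Point e) →
                         π (combination μ p) ≋ combination μ (π ∘ p)
    linear-combination {zero}  μ p = 0ᴹ-homo
    linear-combination {suc m} μ p j = begin
      π (combination μ p) j                                                    ≈⟨ +ᴹ-homo _ _ j ⟩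
      π (λ i → μ zero * p zero i) j + π (combination (μ ∘ suc) (p ∘ suc)) j    ≈⟨ +-cong (*ₗ-homo (μ zero) (p zero) j) (linear-combination (μ ∘ suc) (p ∘ suc) j) ⟩
      combination μ (π ∘ p) j                                                  ∎

    linear-matrix : ∀ x j → π x j ≈ (λ i → π (single i 1#) j) ∙ x
    linear-matrix x j = begin
      π x j                                            ≈⟨ ⟦⟧-cong (λ l → sym (begin
        x ∙ (λ i → single i 1# l)                        ≈⟨ sum-cong-≋ (λ i → *-congˡ (single-swap i l)) ⟩
        x ∙ single l 1#                                  ≈⟨ ∙-comm x (single l 1#) ⟩
        single l 1# ∙ x                                  ≈⟨ single-∙ l 1# x ⟩
        1# * x l                                         ≈⟨ *-identityˡ (x l) ⟩
        x l                                              ∎)) j ⟩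
      π (combination x (λ i → single i 1#)) j          ≈⟨ linear-combination x (λ i → single i 1#) j ⟩
      x ∙ (λ i → π (single i 1#) j)                    ≈⟨ ∙-comm x _ ⟩
      (λ i → π (single i 1#) j) ∙ x                    ∎
      where
      single-swap : ∀ {n} (i l : Fin n) → single i 1# l ≈ single l 1# i
      single-swap zero    zero    = refl
      single-swap zero    (suc l) = refl
      single-swap (suc i) zero    = refl
      single-swap (suc i) (suc l) = single-swap i l

  -- Raising L preserves the inequality at an entry because x ≥ 0, so the sum of bounds for the
  -- single entries serves for all and no maximum has to be chosen.
  dominate : ∀ {n} (x y : Vector Carrier n) → (∀ i → 0# ≤ x i) → (∀ i → x i ≈ 0# → y i ≈ 0#) →
             ¬ ¬ (∃[ L ] 0# ≤ L × (∀ i → 0# ≤ L * x i + y i))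
  dominate {zero}  x y 0≤x x≈0⇒y≈0 = pure (0# , 0≤0 , λ ())
  dominate {suc n} x y 0≤x x≈0⇒y≈0 = do
    (L , 0≤L , tail) ← dominate (x ∘ suc) (y ∘ suc) (0≤x ∘ suc) (x≈0⇒y≈0 ∘ suc)
    (l , 0≤l , head) ← dominate₀
    pure (l + L , 0≤-+ 0≤l 0≤L , ∀-cons (raise (x zero) (y zero) l L 0≤L (0≤x zero) head)
      λ i → ≤-respʳ-≈ (+-congʳ (*-congʳ (+-comm L l))) (raise (x (suc i)) (y (suc i)) L l 0≤l (0≤x (suc i)) (tail i)))
    where
    raise : ∀ x y l L → 0# ≤ L → 0# ≤ x → 0# ≤ l * x + y → 0# ≤ (l + L) * x + y
    raise x y l L 0≤L 0≤x 0≤lx+y = ≤-respʳ-≈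
      (solve 4 (λ x y l L → L :* x :+ (l :* x :+ y) := (l :+ L) :* x :+ y) refl x y l L) (0≤-+ (0≤-* 0≤L 0≤x) 0≤lx+y)
    dominate₀ : ¬ ¬ (∃[ l ] 0# ≤ l × 0# ≤ l * x zero + y zero)
    dominate₀ = do
      no x₀≉0 ← em {A = x zero ≈ 0#}
        where yes x₀≈0 → pure (0# , 0≤0 , ≈⇒≤ (sym (trans (+-cong (zeroˡ _) (x≈0⇒y≈0 zero x₀≈0)) (+-identityʳ 0#))))
      (z , x₀z≈1) ← inverse x₀≉0
      inj₂ 0≤-y₀ ← 0≤-total (y zero)
        where inj₁ 0≤y₀ → pure (0# , 0≤0 , ≤-respʳ-≈ (sym (trans (+-congʳ (zeroˡ _)) (+-identityˡ _))) 0≤y₀)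
      pure (- y zero * z , 0≤-* 0≤-y₀ (0≤-inverse (0≤x zero) x₀z≈1) , ≈⇒≤ (sym (begin
        - y zero * z * x zero + y zero       ≈⟨ solve 3 (λ x y z → :- y :* z :* x :+ y := y :+ :- y :* (x :* z)) refl (x zero) (y zero) z ⟩
        y zero + - y zero * (x zero * z)     ≈⟨ +-congˡ (trans (*-congˡ x₀z≈1) (*-identityʳ _)) ⟩
        y zero - y zero                      ≈⟨ -‿inverseʳ _ ⟩
        0#                                   ∎)))

  module Extension {e d} (Q : Polytope e) (P : Polytope d) {π : Point e → Point d} (linear : IsLinear π)
                   (π[Q]≐P : image π ⟦ Q ⟧ ≐ ⟦ P ⟧)
                   {k} (facet : Fin k → ValidInequality Q)
                   (complete : ∀ h → IsFacet {Q = Q} h → ∃[ j ] face (facet j) ≐ face h) where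

    open Polytope Q renaming (generators to g)

    S : Fin k → Vector Carrier (suc e)
    S j = slack Q (facet j)

    Π : Fin d → Vector Carrier (suc e)
    Π r = 0# ∷ λ i → π (single i 1#) r

    Π-∙ : ∀ r x → Π r ∙ x ̂ ≈ π x r
    Π-∙ r x = trans (+-congʳ (zeroˡ 1#)) (trans (+-identityˡ _) (sym (linear-matrix linear x r)))

    π∈P : ∀ {x} → x ∈ ⟦ Q ⟧ → π x ∈ ⟦ P ⟧
    π∈P x∈Q = proj₁ π[Q]≐P (_ , x∈Q , λ _ → refl)

    -- An expansion of π - v on Q in those slacks that vanish at one chosen point over v. The
    -- coefficients may be negative.
    record LocalCoordinates (v : Point d) : Set (c ⊔ ℓ₁ ⊔ ℓ₂) where
      field
        preimage  : Point e
        preimage∈ : preimage ∈ ⟦ Q ⟧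
        projects  : π preimage ≋ v
        coeff     : Fin d → Vector Carrier k
        coeff≈0   : ∀ r j → ¬ S j ∙ preimage ̂ ≈ 0# → coeff r j ≈ 0#
        expansion : ∀ r i → Π r ∙ ĝ Q i ≈ v r + coeff r ∙ (λ j → S j ∙ ĝ Q i)

      Tight : Fin k → Set ℓ₁
      Tight j = S j ∙ preimage ̂ ≈ 0#

    module _ (h : ValidInequality P) where

      open ValidInequality h

      pullback : Vector Carrier (suc e)
      pullback = affine (λ i → normal ∙ (λ r → π (single i 1#) r)) bound

      pullback-∙ : ∀ x → pullback ∙ x ̂ ≈ bound - normal ∙ π x
      pullback-∙ x = trans (affine-∙ _ bound x) (+-congˡ (-‿cong (begin
        (λ i → normal ∙ (λ r → π (single i 1#) r)) ∙ x      ≈⟨ ∙-assoc normal (λ r i → π (single i 1#) r) x ⟨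
        normal ∙ (λ r → (λ i → π (single i 1#) r) ∙ x)      ≈⟨ ∙-congˡ {x = normal} (linear-matrix linear x) ⟨
        normal ∙ π x                                        ∎)))

      0≤pullback : ∀ {x} → x ∈ ⟦ Q ⟧ → 0# ≤ pullback ∙ x ̂
      0≤pullback {x} x∈Q = ≤-respʳ-≈ (sym (pullback-∙ x)) (≤⇒0≤- (valid (π∈P x∈Q)))

      pullback≈0⇒face : ∀ {x} → x ∈ ⟦ Q ⟧ → pullback ∙ x ̂ ≈ 0# → π x ∈ face h
      pullback≈0⇒face {x} x∈Q F≈0 = π∈P x∈Q , x-y≈0⇒y≈x (trans (sym (pullback-∙ x)) F≈0)

    generate : ∀ F → (∀ i → 0# ≤ F ∙ ĝ Q i) → ¬ ¬ Generated Q facet complete F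
    generate F 0≤F = nonNegative⇒generated Q facet complete _ Subset.⊤ F ℕ.≤-refl (λ i → inj₁ Subset.∈⊤) 0≤F

    -- Complementary slackness: at x the nonnegative terms of the combination add up to 0, so each
    -- vanishes, and a nonzero slack forces its coefficient to be 0.
    inactive : ∀ {F x} → x ∈ ⟦ Q ⟧ → F ∙ x ̂ ≈ 0# → (gen : Generated Q facet complete F) →
               ∀ j → ¬ S j ∙ x ̂ ≈ 0# → proj₁ gen j ≈ 0#
    inactive {F} {x} x∈Q Fx≈0 (μ , 0≤μ , F≈μS) j Sx≉0 =
      *-cancelˡ-0 Sx≉0 (trans (*-comm _ _) (sum≈0⇒≈0 (λ j → 0≤-* (0≤μ j) (0≤slack Q (facet j) x∈Q)) (begin
        μ ∙ (λ j → S j ∙ x ̂)                              ≈⟨ ∙-congˡ {x = μ} (λ j → hull-∙ Q x∈Q (S j)) ⟩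
        μ ∙ (λ j → weight ∙ (λ i → S j ∙ ĝ Q i))          ≈⟨ ∙-swap weight μ (λ j i → S j ∙ ĝ Q i) ⟨
        weight ∙ (λ i → μ ∙ (λ j → S j ∙ ĝ Q i))          ≈⟨ ∙-congˡ {x = weight} F≈μS ⟨
        weight ∙ (λ i → F ∙ ĝ Q i)                        ≈⟨ hull-∙ Q x∈Q F ⟨
        F ∙ x ̂                                            ≈⟨ Fx≈0 ⟩
        0#                                                ∎) j))
      where open ConvexHull x∈Q

    -- If F is the pullback of an inequality supporting P at v only, then
    -- L F + (Π r - v r) is nonnegative on Q for L large enough, and Π r - v r is the
    -- difference of two functionals which vanish above v.
    localCoordinates : ∀ {v} → IsVertex P v → ¬ ¬ LocalCoordinates v
    localCoordinates {v} (h , face⊆ , ⊆face) = do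
      coordinates ← ¬¬-∀ coordinate
      pure record
        { preimage  = w ; preimage∈ = w∈Q ; projects = πw≋v
        ; coeff     = λ r → proj₁ (coordinates r)
        ; coeff≈0   = λ r → proj₁ (proj₂ (coordinates r))
        ; expansion = λ r → proj₂ (proj₂ (coordinates r)) }
      where
      v∈face : v ∈ face h
      v∈face = ⊆face (λ _ → refl)
      lifted = proj₂ π[Q]≐P (proj₁ v∈face)
      w = proj₁ lifted
      w∈Q = proj₁ (proj₂ lifted)
      πw≋v = proj₂ (proj₂ lifted)
      open ValidInequality h
      F = pullback h
      Fw≈0 : F ∙ w ̂ ≈ 0#
      Fw≈0 = begin
        F ∙ w ̂                  ≈⟨ pullback-∙ h w ⟩
        bound - normal ∙ π w    ≈⟨ +-congˡ (-‿cong (∙-congˡ {x = normal} πw≋v)) ⟩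
        bound - normal ∙ v      ≈⟨ +-congˡ (-‿cong (proj₂ v∈face)) ⟩
        bound - bound           ≈⟨ -‿inverseʳ bound ⟩
        0#                      ∎
      Coordinate : Fin d → Set _
      Coordinate r = ∃[ κ ] (∀ j → ¬ S j ∙ w ̂ ≈ 0# → κ j ≈ 0#) ×
                            (∀ i → Π r ∙ ĝ Q i ≈ v r + κ ∙ (λ j → S j ∙ ĝ Q i))
      difference : ∀ {L a p t} → L * a + (p + - t * 1#) + - L * a + t ≈ p
      difference {L} {a} {p} {t} =
        solve 4 (λ L a p t → L :* a :+ (p :+ :- t :* con (+ 1)) :+ :- L :* a :+ t := p) refl L a p t
      coordinate : ∀ r → ¬ ¬ Coordinate r
      coordinate r = do
        -- A generator at which F vanishes projects into the face that consists of v alone, so Π r -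
        -- v r vanishes there as well, as `dominate` requires.
        (L , 0≤L , bounds) ← dominate (λ i → F ∙ ĝ Q i) (λ i → Π r ∙ ĝ Q i + - v r * 1#)
          (λ i → 0≤pullback h (generator∈ Q i))
          (λ i Fi≈0 → trans (+-cong
             (trans (Π-∙ r (g i)) (sym (face⊆ (pullback≈0⇒face h (generator∈ Q i) Fi≈0) r))) (*-identityʳ _))
             (-‿inverseʳ (v r)))
        let G : Vector Carrier (suc e)
            G = (λ j → (Π r j + - v r * single zero 1# j) + L * F j)
            G-∙ : ∀ x → G ∙ x ̂ ≈ L * (F ∙ x ̂) + (Π r ∙ x ̂ + - v r * 1#)
            G-∙ x = begin
              G ∙ x ̂                                                        ≈⟨ ∙-linearˡ (λ j → Π r j + - v r * single zero 1# j) F (x ̂) L ⟩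
              (λ j → Π r j + - v r * single zero 1# j) ∙ x ̂ + L * (F ∙ x ̂)  ≈⟨ +-congʳ (∙-linearˡ (Π r) (single zero 1#) (x ̂) (- v r)) ⟩
              Π r ∙ x ̂ + - v r * (single zero 1# ∙ x ̂) + L * (F ∙ x ̂)       ≈⟨ +-comm _ _ ⟩
              L * (F ∙ x ̂) + (Π r ∙ x ̂ + - v r * (single zero 1# ∙ x ̂))     ≈⟨ +-congˡ (+-congˡ (*-congˡ (trans (single-∙ zero 1# (x ̂)) (*-identityˡ 1#)))) ⟩
              L * (F ∙ x ̂) + (Π r ∙ x ̂ + - v r * 1#)                        ∎
            Gw≈0 : G ∙ w ̂ ≈ 0#
            Gw≈0 = begin
              G ∙ w ̂                                     ≈⟨ G-∙ w ⟩
              L * (F ∙ w ̂) + (Π r ∙ w ̂ + - v r * 1#)     ≈⟨ +-cong (trans (*-congˡ Fw≈0) (zeroʳ L)) (+-cong (trans (Π-∙ r w) (πw≋v r)) (*-identityʳ _)) ⟩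
              0# + (v r - v r)                           ≈⟨ trans (+-identityˡ _) (-‿inverseʳ (v r)) ⟩
              0#                                         ∎
        genF ← generate F (λ i → 0≤pullback h (generator∈ Q i))
        genG ← generate G (λ i → ≤-respʳ-≈ (sym (G-∙ (g i))) (bounds i))
        pure (combineGenerated L G G-∙ Gw≈0 genF genG)
        where
        combineGenerated : ∀ L G → (∀ x → G ∙ x ̂ ≈ L * (F ∙ x ̂) + (Π r ∙ x ̂ + - v r * 1#)) → G ∙ w ̂ ≈ 0# →
          Generated Q facet complete F → Generated Q facet complete G → Coordinate r
        combineGenerated L G G-∙ Gw≈0 genF@(μ , _ , F≈) genG@(ν , _ , G≈) =
          (λ j → ν j + - L * μ j) ,
          (λ j Sj≉0 → trans (+-cong (inactive {G} w∈Q Gw≈0 genG j Sj≉0)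
             (trans (*-congˡ (inactive {F} w∈Q Fw≈0 genF j Sj≉0)) (zeroʳ _))) (+-identityʳ 0#)) ,
          λ i → begin
            Π r ∙ ĝ Q i
              ≈⟨ difference {L} {F ∙ ĝ Q i} {Π r ∙ ĝ Q i} {v r} ⟨
            L * (F ∙ ĝ Q i) + (Π r ∙ ĝ Q i + - v r * 1#) + - L * (F ∙ ĝ Q i) + v r
              ≈⟨ +-congʳ (+-cong (trans (sym (G-∙ (g i))) (G≈ i)) (*-congˡ (F≈ i))) ⟩
            ν ∙ (λ j → S j ∙ ĝ Q i) + - L * (μ ∙ (λ j → S j ∙ ĝ Q i)) + v r
              ≈⟨ +-comm _ _ ⟩
            v r + (ν ∙ (λ j → S j ∙ ĝ Q i) + - L * (μ ∙ (λ j → S j ∙ ĝ Q i)))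
              ≈⟨ +-congˡ (∙-linearˡ ν μ (λ j → S j ∙ ĝ Q i) (- L)) ⟨
            v r + (λ j → ν j + - L * μ j) ∙ (λ j → S j ∙ ĝ Q i) ∎

    module _ {v} (C : LocalCoordinates v) where

      open LocalCoordinates C

      hull-expansion : ∀ {x} → x ∈ ⟦ Q ⟧ → ∀ r → π x r ≈ v r + coeff r ∙ (λ j → S j ∙ x ̂)
      hull-expansion {x} x∈Q r = begin
        π x r
          ≈⟨ Π-∙ r x ⟨
        Π r ∙ x ̂
          ≈⟨ hull-∙ Q x∈Q (Π r) ⟩
        weight ∙ (λ i → Π r ∙ ĝ Q i)
          ≈⟨ ∙-congˡ {x = weight} (λ i → trans (expansion r i) (trans (+-comm _ _) (+-congˡ (sym (*-identityʳ (v r)))))) ⟩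
        weight ∙ (λ i → coeff r ∙ (λ j → S j ∙ ĝ Q i) + v r * 1#)
          ≈⟨ ∙-linearʳ weight (λ i → coeff r ∙ (λ j → S j ∙ ĝ Q i)) (λ _ → 1#) (v r) ⟩
        weight ∙ (λ i → coeff r ∙ (λ j → S j ∙ ĝ Q i)) + v r * (weight ∙ (λ _ → 1#))
          ≈⟨ +-cong (∙-swap weight (coeff r) (λ j i → S j ∙ ĝ Q i)) (*-congˡ (trans (sum-cong-≋ λ i → *-identityʳ (weight i)) sum≈1)) ⟩
        coeff r ∙ (λ j → weight ∙ (λ i → S j ∙ ĝ Q i)) + v r * 1#
          ≈⟨ +-cong (∙-congˡ {x = coeff r} (λ j → sym (hull-∙ Q x∈Q (S j)))) (*-identityʳ (v r)) ⟩
        coeff r ∙ (λ j → S j ∙ x ̂) + v r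
          ≈⟨ +-comm _ _ ⟩
        v r + coeff r ∙ (λ j → S j ∙ x ̂) ∎
        where open ConvexHull x∈Q

    -- Evaluate the expansion around v at the chosen point over v′: a slack not tight over v has
    -- coefficient 0, and a tight one vanishes over v′ by the inclusion. An inclusion, not only an
    -- equality, thus forces v = v′, which yields the antichain.
    tight-injective : ∀ {v v′} (C : LocalCoordinates v) (C′ : LocalCoordinates v′) →
      (∀ j → LocalCoordinates.Tight C j → LocalCoordinates.Tight C′ j) → v ≋ v′
    tight-injective {v} {v′} C C′ tight⊆ r = sym (begin
      v′ r                                            ≈⟨ C′.projects r ⟨
      π C′.preimage r                                 ≈⟨ hull-expansion C C′.preimage∈ r ⟩
      v r + C.coeff r ∙ (λ j → S j ∙ C′.preimage ̂)    ≈⟨ +-congˡ (sum-zero λ j → ≈-stable (vanishes j)) ⟩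
      v r + 0#                                        ≈⟨ +-identityʳ (v r) ⟩
      v r                                             ∎)
      where
      module C = LocalCoordinates C
      module C′ = LocalCoordinates C′
      vanishes : ∀ j → ¬ ¬ (C.coeff r j * (S j ∙ C′.preimage ̂) ≈ 0#)
      vanishes j = do
        yes t ← em {A = C.Tight j}
          where no ¬t → pure (trans (*-congʳ (C.coeff≈0 r j ¬t)) (zeroˡ _))
        pure (trans (*-congˡ (tight⊆ j t)) (zeroʳ _))

    -- Vertex coordinates lie in the field generated by the linear relations on Q

    functional : Fin (suc (d ℕ.+ k)) → Vector Carrier (suc e)
    functional = single zero 1# ∷ (Π ++ S)

    -- Linear relations between these vectors are the linear relations between the functions on Q,
    -- whether or not Q is full-dimensional.
    values : Fin (suc (d ℕ.+ k)) → Vector Carrier size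
    values a i = functional a ∙ ĝ Q i

    Π-index : Fin d → Fin (suc (d ℕ.+ k))
    Π-index r = suc (r ↑ˡ k)

    S-index : Fin k → Fin (suc (d ℕ.+ k))
    S-index j = suc (d ↑ʳ j)

    functional-Π : ∀ r x → functional (Π-index r) ∙ x ≈ Π r ∙ x
    functional-Π r x = reflexive (≡.cong (_∙ x) (lookup-++ˡ Π S r))

    functional-S : ∀ j x → functional (S-index j) ∙ x ≈ S j ∙ x
    functional-S j x = reflexive (≡.cong (_∙ x) (lookup-++ʳ Π S j))

    functional-1 : ∀ (x : Point e) → functional zero ∙ x ̂ ≈ 1#
    functional-1 x = trans (single-∙ zero 1# (x ̂)) (*-identityˡ 1#)

    module _ {κ} {K : Carrier → Set κ} (subfield : IsSubfield K)
             {ρ} (b : Fin ρ → Fin (suc (d ℕ.+ k))) (independent : Independent (values ∘ b))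
             (R : Fin (suc (d ℕ.+ k)) → Vector Carrier ρ) (R∈K : ∀ a l → K (R a l))
             (values≈ : ∀ a i → values a i ≈ R a ∙ (λ l → values (b l) i))
             {v} (C : LocalCoordinates v) where

      open IsSubfield subfield
      open LocalCoordinates C

      private
        σ : Fin (suc k) → Fin (suc (d ℕ.+ k))
        σ = zero ∷ S-index

        z : Vector Carrier ρ
        z l = functional (b l) ∙ preimage ̂

      -- Pairing with z is evaluation at the preimage: relations that hold at the generators hold at
      -- their convex combinations.
      row-∙ : ∀ a → R a ∙ z ≈ functional a ∙ preimage ̂
      row-∙ a = begin
        R a ∙ z                                              ≈⟨ ∙-congˡ {x = R a} (λ l → hull-∙ Q preimage∈ (functional (b l))) ⟩
        R a ∙ (λ l → weight ∙ (λ i → values (b l) i))        ≈⟨ ∙-swap weight (R a) (values ∘ b) ⟨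
        weight ∙ (λ i → R a ∙ (λ l → values (b l) i))        ≈⟨ ∙-congˡ {x = weight} (values≈ a) ⟨
        weight ∙ (λ i → functional a ∙ ĝ Q i)                ≈⟨ hull-∙ Q preimage∈ (functional a) ⟨
        functional a ∙ preimage ̂                             ∎
        where open ConvexHull preimage∈

      -- The expansion over v is a relation between functions on Q; as the basis functions are
      -- independent, the coordinates in that basis satisfy the same relation.
      row-expansion : ∀ r l → R (Π-index r) l ≈ (v r ∷ coeff r) ∙ (λ a → R (σ a) l)
      row-expansion r l = begin
        R (Π-index r) l                                     ≈⟨ solve 2 (λ x y → x := x :+ :- con (+ 1) :* y :+ y) refl _ (expanded l) ⟩
        R (Π-index r) l + - 1# * expanded l + expanded l    ≈⟨ +-congʳ (independent _ vanishes l) ⟩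
        0# + expanded l                                     ≈⟨ +-identityˡ _ ⟩
        expanded l                                          ∎
        where
        expanded : Vector Carrier ρ
        expanded l = (v r ∷ coeff r) ∙ (λ a → R (σ a) l)
        vanishes : ∀ i → (λ l → R (Π-index r) l + - 1# * expanded l) ∙ (λ l → values (b l) i) ≈ 0#
        vanishes i = begin
          (λ l → R (Π-index r) l + - 1# * expanded l) ∙ y
            ≈⟨ ∙-linearˡ (R (Π-index r)) expanded y (- 1#) ⟩
          R (Π-index r) ∙ y + - 1# * (expanded ∙ y)
            ≈⟨ +-cong (sym (values≈ (Π-index r) i)) (*-congˡ (sym (∙-assoc (v r ∷ coeff r) (R ∘ σ) y))) ⟩
          values (Π-index r) i + - 1# * ((v r ∷ coeff r) ∙ (λ a → R (σ a) ∙ y))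
            ≈⟨ +-cong (trans (functional-Π r (ĝ Q i)) (expansion r i))
                 (*-congˡ (+-cong (trans (*-congˡ (trans (sym (values≈ zero i)) (functional-1 (g i)))) (*-identityʳ _))
                    (∙-congˡ {x = coeff r} λ j → trans (sym (values≈ (S-index j) i)) (functional-S j (ĝ Q i))))) ⟩
          v r + coeff r ∙ (λ j → S j ∙ ĝ Q i) + - 1# * (v r + coeff r ∙ (λ j → S j ∙ ĝ Q i))
            ≈⟨ solve 1 (λ x → x :+ :- con (+ 1) :* x := con (+ 0)) refl _ ⟩
          0# ∎
          where
          y : Vector Carrier ρ
          y l = values (b l) i

      -- Replacing a row that is not tight by the zero row, instead of removing it, keeps the index
      -- set fixed while tightness is known only inside ¬ ¬.
      mask : ∀ {a} {A : Set a} → Dec A → Vector Carrier ρ → Vector Carrier ρ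
      mask (yes _) x = x
      mask (no  _) x = λ _ → 0#

      -- v r is the coefficient of R zero in any expansion of R (Π-index r) in
      -- the rows R zero and R (S-index j), j tight, hence in one over K.
      coordinate∈ : ∀ r → ¬ ¬ K (v r)
      coordinate∈ r = do
        tight? ← ¬¬-∀ {P = λ j → Dec (Tight j)} λ j → em
        -- The coefficients `v r ∷ coeff r` already solve the masked system over ℝ, which refutes
        -- the other alternative.
        inj₁ (μ , μ∈ , R≈) ← separate subfield (rows tight?) (R (Π-index r)) (rows∈ tight?) (R∈K (Π-index r))
          where inj₂ (u , _ , ub≈0 , uR≈1) → contradiction (begin
                  1#                                                              ≈⟨ uR≈1 ⟨
                  u ∙ R (Π-index r)                                               ≈⟨ ∙-congˡ {x = u} (masked tight?) ⟩
                  u ∙ (λ l → (v r ∷ coeff r) ∙ (λ a → rows tight? a l))           ≈⟨ ∙-swap u (v r ∷ coeff r) (rows tight?) ⟩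
                  (v r ∷ coeff r) ∙ (λ a → u ∙ rows tight? a)                     ≈⟨ ∙-zeroʳ {x = v r ∷ coeff r} ub≈0 ⟩
                  0#                                                              ∎) 1≉0
        pure (∈-resp (sym (head≈ tight? μ R≈)) (μ∈ zero))
        where
        rows : (∀ j → Dec (Tight j)) → Fin (suc k) → Vector Carrier ρ
        rows tight? = R zero ∷ λ j → mask (tight? j) (R (S-index j))
        rows∈ : ∀ tight? a l → K (rows tight? a l)
        rows∈ tight? zero l = R∈K zero l
        rows∈ tight? (suc j) l with tight? j
        ... | yes _ = R∈K (S-index j) l
        ... | no  _ = 0∈
        masked : ∀ tight? l → R (Π-index r) l ≈ (v r ∷ coeff r) ∙ (λ a → rows tight? a l)
        masked tight? l = trans (row-expansion r l) (+-congˡ (sum-cong-≋ same))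
          where
          same : ∀ j → coeff r j * R (S-index j) l ≈ coeff r j * rows tight? (suc j) l
          same j with tight? j
          ... | yes _ = refl
          ... | no ¬t = trans (trans (*-congʳ (coeff≈0 r j ¬t)) (zeroˡ _)) (sym (zeroʳ _))
        rows-∙ : ∀ tight? j → rows tight? (suc j) ∙ z ≈ 0#
        rows-∙ tight? j with tight? j
        ... | yes t = trans (row-∙ (S-index j)) (trans (functional-S j (preimage ̂)) t)
        ... | no  _ = ∙-zeroˡ {x = λ _ → 0#} {y = z} λ _ → refl
        -- Evaluation at the preimage sends `R zero` to 1 and every tight or masked row to 0, so it
        -- reads off the first coefficient of any expansion.
        head≈ : ∀ tight? μ → (∀ l → R (Π-index r) l ≈ μ ∙ (λ a → rows tight? a l)) → v r ≈ μ zero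
        head≈ tight? μ R≈ = begin
          v r                                                              ≈⟨ projects r ⟨
          π preimage r                                                     ≈⟨ Π-∙ r preimage ⟨
          Π r ∙ preimage ̂                                                  ≈⟨ functional-Π r (preimage ̂) ⟨
          functional (Π-index r) ∙ preimage ̂                               ≈⟨ row-∙ (Π-index r) ⟨
          R (Π-index r) ∙ z                                                ≈⟨ ∙-congʳ {x = z} R≈ ⟩
          (λ l → μ ∙ (λ a → rows tight? a l)) ∙ z                          ≈⟨ ∙-assoc μ (rows tight?) z ⟨
          μ zero * (R zero ∙ z) + (μ ∘ suc) ∙ (λ j → rows tight? (suc j) ∙ z)
            ≈⟨ +-cong (*-congˡ (trans (row-∙ zero) (functional-1 preimage))) (∙-zeroʳ {x = μ ∘ suc} (rows-∙ tight?)) ⟩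
          μ zero * 1# + 0#                                                 ≈⟨ trans (+-identityʳ _) (*-identityʳ _) ⟩
          μ zero                                                           ∎

    module _ (B : Basis values (λ _ → ⊤)) where

      open Basis B

      -- Rows of basis members are unit vectors; only the rows of `rest` contribute parameters.
      parameters : Vector Carrier (corank ℕ.* rank)
      parameters = concat (λ l → proj₁ (spanning (rest l) tt))

      private
        Row : Fin (suc (d ℕ.+ k)) → Set _
        Row a = ∃[ R ] (∀ l → Rational parameters (R l)) × (∀ i → values a i ≈ R ∙ (λ l → values (basis l) i))

        row : ∀ a → Row a
        row a with basis⊎rest a
        ... | inj₁ (l , ≡.refl) = single l 1#
          , IsSubfield.single∈ (isSubfield parameters) l (rational-1 parameters)
          , λ i → sym (trans (single-∙ l 1# (λ l → values (basis l) i)) (*-identityˡ _))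
        ... | inj₂ (l , ≡.refl) = proj₁ (spanning (rest l) tt)
          , (λ j → IsSubfield.∈-resp (isSubfield parameters)
              (reflexive (concat-combine (λ l → proj₁ (spanning (rest l) tt)) l j)) (variable∈ parameters (combine l j)))
          , proj₂ (spanning (rest l) tt)

      coordinate-rational : ∀ {v} → LocalCoordinates v → ∀ r → ¬ ¬ Rational parameters (v r)
      coordinate-rational C r = coordinate∈ (isSubfield parameters) basis independent
        (λ a → proj₁ (row a)) (λ a → proj₁ (proj₂ (row a))) (λ a → proj₂ (proj₂ (row a))) C r

-- Two combinatorial estimates

product≤square : ∀ {a b k} → 3 ℕ.≤ k → a ℕ.+ b ≡ 3 ℕ.+ k → b ℕ.* a ℕ.≤ k ℕ.* k
product≤square {a} {b} {k} 3≤k a+b≡3+k = ℕ.*-cancelˡ-≤ 4 (begin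
  4 ℕ.* (b ℕ.* a)              ≤⟨ amgm (ℕ.≤-total a b) ⟩
  (a ℕ.+ b) ℕ.* (a ℕ.+ b)      ≡⟨ ≡.cong (λ m → m ℕ.* m) a+b≡3+k ⟩
  -- For k ≥ 3 the sum 3 + k is at most 2 k, which is what the bound from the antichain serves for.
  (3 ℕ.+ k) ℕ.* (3 ℕ.+ k)      ≤⟨ ℕ.*-mono-≤ (ℕ.+-monoˡ-≤ k 3≤k) (ℕ.+-monoˡ-≤ k 3≤k) ⟩
  (k ℕ.+ k) ℕ.* (k ℕ.+ k)      ≡⟨ solve 1 (λ k → (k :+ k) :* (k :+ k) := con 4 :* (k :* k)) ≡.refl k ⟩
  4 ℕ.* (k ℕ.* k)              ∎)
  where
  open ℕ.≤-Reasoning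
  open +-*-Solver
  -- The factors are m and m + n, and the square of their sum exceeds four times their product by
  -- n².
  gap : ∀ m n → 4 ℕ.* ((m ℕ.+ n) ℕ.* m) ℕ.≤ (m ℕ.+ (m ℕ.+ n)) ℕ.* (m ℕ.+ (m ℕ.+ n))
  gap m n = begin
    4 ℕ.* ((m ℕ.+ n) ℕ.* m)                        ≤⟨ ℕ.m≤m+n _ (n ℕ.* n) ⟩
    4 ℕ.* ((m ℕ.+ n) ℕ.* m) ℕ.+ n ℕ.* n            ≡⟨ solve 2 (λ m n → con 4 :* ((m :+ n) :* m) :+ n :* n := (m :+ (m :+ n)) :* (m :+ (m :+ n))) ≡.refl m n ⟩
    (m ℕ.+ (m ℕ.+ n)) ℕ.* (m ℕ.+ (m ℕ.+ n))        ∎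
  amgm : a ℕ.≤ b ⊎ b ℕ.≤ a → 4 ℕ.* (b ℕ.* a) ℕ.≤ (a ℕ.+ b) ℕ.* (a ℕ.+ b)
  amgm (inj₁ a≤b) = ≡.subst (λ b → 4 ℕ.* (b ℕ.* a) ℕ.≤ (a ℕ.+ b) ℕ.* (a ℕ.+ b)) (ℕ.m+[n∸m]≡n a≤b) (gap a (b ℕ.∸ a))
  amgm (inj₂ b≤a) = ≡.subst₂ ℕ._≤_ (≡.cong (4 ℕ.*_) (ℕ.*-comm a b)) (≡.cong (λ m → m ℕ.* m) (ℕ.+-comm b a))
    (≡.subst (λ a → 4 ℕ.* (a ℕ.* b) ℕ.≤ (b ℕ.+ a) ℕ.* (b ℕ.+ a)) (ℕ.m+[n∸m]≡n b≤a) (gap b (a ℕ.∸ b)))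

Antichain : ∀ {k} (p q r : Subset k) → Set
Antichain p q r = (¬ p Subset.⊆ q × ¬ q Subset.⊆ p) × (¬ p Subset.⊆ r × ¬ r Subset.⊆ p) × (¬ q Subset.⊆ r × ¬ r Subset.⊆ q)

-- The largest antichains of subsets of a set with 0, 1 or 2 elements have 1, 1 and 2 members; here
-- the three cases are decided by exhaustive search.
no-antichain : ∀ {k} → k ℕ.< 3 → ¬ (∃[ p ] ∃[ q ] ∃[ r ] Antichain {k} p q r)
no-antichain = small _
  where
  _⊈?_ : ∀ {k} (p q : Subset k) → Dec (¬ p Subset.⊆ q)
  p ⊈? q = ¬? (p Subset.⊆? q)
  antichain? : ∀ k → Dec (∃[ p ] ∃[ q ] ∃[ r ] Antichain {k} p q r)
  antichain? k = Subset.anySubset? λ p → Subset.anySubset? λ q → Subset.anySubset? λ r →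
    ((p ⊈? q) ×-dec (q ⊈? p)) ×-dec (((p ⊈? r) ×-dec (r ⊈? p)) ×-dec ((q ⊈? r) ×-dec (r ⊈? q)))
  small : ∀ k → k ℕ.< 3 → ¬ (∃[ p ] ∃[ q ] ∃[ r ] Antichain {k} p q r)
  small 0 _ = from-no (antichain? 0)
  small 1 _ = from-no (antichain? 1)
  small 2 _ = from-no (antichain? 2)
  small (suc (suc (suc k))) (s≤s (s≤s (s≤s ())))

module _ {a k} {A : Fin k → Set a} (A? : ∀ j → Dec (A j)) where

  toSubset : Subset k
  toSubset = Vec.tabulate (λ j → does (A? j))

  ∈-toSubset⁺ : ∀ {j} → A j → j Subset.∈ toSubset
  ∈-toSubset⁺ {j} Aj = Vec.lookup⇒[]= j toSubset (≡.trans (Vec.lookup∘tabulate _ j) (dec-true (A? j) Aj))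

  ∈-toSubset⁻ : ∀ {j} → j Subset.∈ toSubset → A j
  ∈-toSubset⁻ {j} j∈ with A? j | ≡.trans (≡.sym (Vec.lookup∘tabulate (λ j → does (A? j)) j)) (Vec.[]=⇒lookup j∈)
  ... | yes Aj | _  = Aj
  ... | no  _  | ()

-- The lower bound on the number of facets

module LowerBound {c ℓ₁ ℓ₂} (ℝ : Reals c ℓ₁ ℓ₂) where

  open Polytopes ℝ hiding (zero; sum; _∙_)
  open OrderedField ℝ
  open Transcendence ℝ
  open Extensions ℝ
  open IntegerMultiples commutativeRing
  open Mult (CommutativeRing.semiring commutativeRing) using (×1-homo-*; ×-homo-+)
  private module < = IsStrictPartialOrder isStrictPartialOrder

  module _ {n} (3≤n : 3 ℕ.≤ n) (P : ConvexPolygon n) (generic : IsGeneric P) where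

    open ConvexPolygon P

    size-bound : ∀ {k} → HasExtensionOfSize polytope k → ¬ ¬ (2 ℕ.* n ℕ.≤ k ℕ.* k)
    size-bound {k} (e , Q , (π , linear , π[Q]≐P) , facets) = do
      local ← ¬¬-∀ λ i → localCoordinates (proj₂ (Bijection.to vertices i))
      tight? ← ¬¬-∀ λ i → ¬¬-∀ {P = λ j → Dec (LocalCoordinates.Tight (local i) j)} λ j → em
      B ← chooseBasis values {D = λ _ → ⊤} (λ _ → yes tt)
      rational ← ¬¬-∀ λ i → ¬¬-∀ λ r → coordinate-rational B (local i) r
      pure (begin
        2 ℕ.* n                                     ≡⟨ ℕ.*-comm 2 n ⟩
        n ℕ.* 2                                     ≤⟨ ℕ.≮⇒≥ (λ m<2n → rational⇒dependent (parameters B) coordinates m<2n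
                                                         (λ l → rational (proj₂ (quotRem {n} 2 l)) (proj₁ (quotRem {n} 2 l)))
                                                         (IsGeneric.independent generic)) ⟩
        -- For d = 2 the family consists of 1 + 2 + k functions, so rank and corank add up to 3 + k.
        Basis.corank B ℕ.* Basis.rank B             ≤⟨ product≤square {Basis.rank B} {Basis.corank B} (3≤k local tight?) (Basis.rank+corank B) ⟩
        k ℕ.* k                                     ∎)
      where
      open ℕ.≤-Reasoning
      facet : Fin k → ValidInequality Q
      facet j = proj₁ (Bijection.to facets j)
      allFacets : ∀ h → IsFacet {Q = Q} h → ∃[ j ] face (facet j) ≐ face h
      -- Facets are compared as sets, so surjectivity provides an index with the same face, not with
      -- the same inequality.
      allFacets h h-isFacet = Bijection.strictlySurjective facets (h , h-isFacet)
      open Extension Q polytope linear π[Q]≐P facet allFacets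
      3≤k : (local : ∀ i → LocalCoordinates (vertex i)) →
            (∀ i j → Dec (LocalCoordinates.Tight (local i) j)) → 3 ℕ.≤ k
      3≤k local tight? = ℕ.≮⇒≥ λ k<3 → no-antichain k<3 (T i₀ , T i₁ , T i₂ ,
        (incomparable (λ ()) , incomparable (λ ())) , (incomparable (λ ()) , incomparable (λ ())) , (incomparable (λ ()) , incomparable (λ ())))
        where
        T : Fin n → Subset k
        T i = toSubset (tight? i)
        index : Fin 3 → Fin n
        index i = inject≤ i 3≤n
        i₀ = index zero
        i₁ = index (suc zero)
        i₂ = index (suc (suc zero))
        incomparable : ∀ {i j} → i ≢ j → ¬ T (index i) Subset.⊆ T (index j)
        incomparable {i} {j} i≢j Tᵢ⊆Tⱼ = i≢j (inject≤-injective 3≤n 3≤n i j (Bijection.injective vertices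
          (tight-injective (local (index i)) (local (index j)) λ l t →
            ∈-toSubset⁻ (tight? (index j)) (Tᵢ⊆Tⱼ (∈-toSubset⁺ (tight? (index i)) t)))))

  0≤fromℕ : ∀ n → 0# ≤ fromℕ n
  0≤fromℕ zero    = 0≤0
  0≤fromℕ (suc n) = <⇒≤ (0<fromℕ[1+n] n)

  fromℕ-mono-≤ : ∀ {m n} → m ℕ.≤ n → fromℕ m ≤ fromℕ n
  fromℕ-mono-≤ {m} {n} m≤n = 0≤-⇒≤ (≤-respʳ-≈ (begin
    fromℕ (n ℕ.∸ m)                        ≈⟨ solve 2 (λ m o → o := m :+ o :- m) refl (fromℕ m) (fromℕ (n ℕ.∸ m)) ⟩
    fromℕ m + fromℕ (n ℕ.∸ m) - fromℕ m    ≈⟨ +-congʳ (×-homo-+ 1# m (n ℕ.∸ m)) ⟨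
    fromℕ (m ℕ.+ (n ℕ.∸ m)) - fromℕ m      ≡⟨ ≡.cong (λ o → fromℕ o - fromℕ m) (ℕ.m+[n∸m]≡n m≤n) ⟩
    fromℕ n - fromℕ m                      ∎) (0≤fromℕ (n ℕ.∸ m)))
    where open SetoidReasoning setoid

  -- If δ = x - y were positive, then -δ² = (y² - x²) + 2 y δ would be nonnegative.
  square-reflects-≤ : ∀ {x y} → 0# ≤ y → x * x ≤ y * y → x ≤ y
  square-reflects-≤ {x} {y} 0≤y x²≤y² y<x = <.irrefl (sym δ²≈0) 0<δ²
    where
    δ = x - y
    0<δ = <⇒0<- y<x
    0<δ² = *-positive 0<δ 0<δ
    0≤yδ = 0≤-* 0≤y (<⇒≤ 0<δ)
    δ²≈0 : δ * δ ≈ 0#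
    δ²≈0 = 0≤-antisym (<⇒≤ 0<δ²) (≤-respʳ-≈
      (solve 2 (λ x y → (y :* y :- x :* x) :+ (y :* (x :- y) :+ y :* (x :- y)) := :- ((x :- y) :* (x :- y))) refl x y)
      (0≤-+ (≤⇒0≤- x²≤y²) (0≤-+ 0≤yδ 0≤yδ)))

theorem3 : ∀ {c ℓ₁ ℓ₂} (ℝ : Reals c ℓ₁ ℓ₂) → let open Polytopes ℝ in
    ∀ (n : ℕ) → 3 ℕ.≤ n → (P : ConvexPolygon n) → IsGeneric P →
    ∀ (k : ℕ) → HasExtensionComplexity (ConvexPolygon.polytope P) k →
    ∀ (s : Carrier) → IsSquareRoot s (fromℕ (2 ℕ.* n)) → s ≤ fromℕ k
theorem3 ℝ n 3≤n P generic k complexity s √2n k<s =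
  size-bound 3≤n P generic (HasExtensionComplexity.attained complexity) λ 2n≤k² →
    square-reflects-≤ (0≤fromℕ k) (≤-respʳ-≈ (×1-homo-* k k)
      (≤-respˡ-≈ (sym (IsSquareRoot.squares √2n)) (fromℕ-mono-≤ 2n≤k²))) k<s
  where
  open Polytopes ℝ
  open OrderedField ℝ using (≤-respʳ-≈; ≤-respˡ-≈)
  open LowerBound ℝ
  open Mult (CommutativeRing.semiring commutativeRing) using (×1-homo-*)
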